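{- Let $\ell$ be an odd prime and fix $\delta\in(0,1)$. For a real number $x>0$, let $\mathcal{A}_{\le x}(\ell)$ be the set of pairs $(t,\alpha)$ where $t\ge2$ is an integer with $t\le x^\delta$ and $\alpha=(\alpha_1,\dots,\alpha_t)\in\mathbb{Z}^t$ is such that $\max\{|\alpha_1|,\dots,|\alpha_t|\}\le x$ and $\ell\nmid\alpha_i$ for some $1\le i\le t$. Let $\mathcal{T}_{\le x}(0,1,\ell)$ be the subset of those $(t,\alpha)\in\mathcal{A}_{\le x}(\ell)$ for which $\mu_\ell(X_t,\alpha)=0$ and $\lambda_\ell(X_t,\alpha)=1$. Then $$\lim_{x\to\infty}\frac{\#\mathcal{T}_{\le x}(0,1,\ell)}{\#\mathcal{A}_{\le x}(\ell)}=1-\ell^{ -1}.$$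
   Context: For $b\in\mathbb{Z}_\ell$ put $\binom{b}{n}=\frac{b(b-1)\cdots(b-n+1)}{n!}\in\mathbb{Z}_\ell$ and $(1+T)^b=\sum_{n\ge0}\binom{b}{n}T^n\in\mathbb{Z}_\ell[[T]]$. The bouquet $X_t$ is the multigraph with one vertex and $t$ undirected loops; a vector $\alpha=(\alpha_1,\dots,\alpha_t)\in\mathbb{Z}_\ell^t$ assigns the voltage $\alpha_j$ to the $j$-th loop. It is admissible if $\alpha\in\mathbb{Z}_\ell^t\setminus(\ell\mathbb{Z}_\ell)^t$. The characteristic series is $$f(T)=f_{X_t,\alpha}(T)=\sum_{j=1}^t\big(2-(1+T)^{\alpha_j}-(1+T)^{ -\alpha_j}\big)\in\mathbb{Z}_\ell[[T]].$$ For admissible $\alpha$ it is nonzero, and it has zero constant term. By Weierstrass preparation write $f(T)=\ell^{\mu}g(T)u(T)$ with $\mu\in\mathbb{Z}_{\ge0}$, $g$ a distinguished polynomial (monic, all non-leading coefficients divisible by $\ell$) and $u\in\mathbb{Z}_\ell[[T]]^\times$. Then $\mu_\ell(X_t,\alpha):=\mu$ and $\lambda_\ell(X_t,\alpha):=\deg g-1$ (note the shift by $-1$). Integral vectors are viewed in $\mathbb{Z}_\ell^t$ via $\mathbb{Z}\subset\mathbb{Z}_\ell$. -}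

module Defs where

open import Algebra.Bundles using (CommutativeRing; module Semiring)
import Algebra.Definitions.RawSemiring as RawSemiringDefs
open import Data.Empty using (⊥-elim)
open import Data.Fin.Base using (Fin; toℕ)
open import Data.Integer.Base as ℤ using (ℤ; +_; -[1+_]; 0ℤ; 1ℤ; ∣_∣)
import Data.Integer.DivMod as ℤ
import Data.Integer.Divisibility as ℤᵤ
open import Data.Integer.Divisibility.Signed as ℤ using (divides)
import Data.Integer.Properties as ℤ
open import Data.Integer.Tactic.RingSolver using (solve-∀)
open import Data.List.Base using (List; length)
open import Data.List.Membership.Propositional using (_∈_)
open import Data.List.Relation.Unary.Unique.Propositional using (Unique)
open import Data.Nat.Base as ℕ using (ℕ; zero; suc; _!; z≤n; s≤s)
import Data.Nat.Divisibility as ℕ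
import Data.Nat.Properties as ℕ
open import Data.Nat.Primality
  using (Prime; prime⇒nonZero; prime⇒nonTrivial; euclidsLemma)
open import Data.Product.Base using (Σ; ∃; _×_; _,_; proj₁; proj₂)
open import Data.Rational.Base as ℚ using (ℚ; 0ℚ; 1ℚ)
import Data.Rational.Properties as ℚ
open import Data.Rational.Unnormalised.Base as ℚᵘ using (mkℚᵘ)
import Data.Rational.Unnormalised.Properties as ℚᵘ
open import Data.Sum.Base using (inj₁; inj₂)
open import Data.Vec.Base as Vec using (Vec)
open import Data.Vec.Functional using (Vector)
open import Function.Bundles using (_⇔_)
open import Level using (0ℓ) renaming (_⊔_ to _⊔ˡ_)
open import Relation.Binary.PropositionalEquality
  using (_≡_; refl; sym; trans; cong; cong₂; subst; subst₂)
open import Relation.Nullary using (¬_; yes; no)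

------------------------------------------------------------------------
-- Real numbers: Dedekind cuts, each represented by its lower set
-- { q ∈ ℚ | q < x }.

record ℝ : Set₁ where
  field
    _∋_       : ℚ → Set
    inhabited : ∃ λ q → _∋_ q
    bounded   : ∃ λ q → ¬ _∋_ q
    down      : ∀ {p q} → p ℚ.< q → _∋_ q → _∋_ p
    open-up   : ∀ {p} → _∋_ p → ∃ λ q → p ℚ.< q × _∋_ q

open ℝ public using (_∋_)

infix 4 _≤ᴿ_ _<ᴿ_

_≤ᴿ_ : ℝ → ℝ → Set
x ≤ᴿ y = ∀ q → x ∋ q → y ∋ q

_<ᴿ_ : ℝ → ℝ → Set
x <ᴿ y = ∃ λ q → ¬ (x ∋ q) × y ∋ q

private
  q-1<q : ∀ q → q ℚ.- 1ℚ ℚ.< q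
  q-1<q q = subst (q ℚ.- 1ℚ ℚ.<_) (ℚ.+-identityʳ q)
    (ℚ.+-monoʳ-< q {ℚ.- 1ℚ} {0ℚ} (ℚ.negative⁻¹ (ℚ.- 1ℚ)))

fromℚ : ℚ → ℝ
fromℚ q = record
  { _∋_       = ℚ._< q
  ; inhabited = q ℚ.- 1ℚ , q-1<q q
  ; bounded   = q , ℚ.<-irrefl refl
  ; down      = ℚ.<-trans
  ; open-up   = λ p<q → let r , p<r , r<q = ℚ.<-dense p<q in r , p<r , r<q
  }

fromℕ : ℕ → ℝ
fromℕ n = fromℚ (+ n ℚ./ 1)

0ᴿ 1ᴿ : ℝ
0ᴿ = fromℕ 0
1ᴿ = fromℕ 1

open RawSemiringDefs ℚ.+-*-rawSemiring public using () renaming (_^_ to _^ℚ_)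

private
  ^-nonNeg : ∀ {a} → 0ℚ ℚ.≤ a → ∀ n → 0ℚ ℚ.≤ a ^ℚ n
  ^-nonNeg 0≤a zero = ℚ.nonNegative⁻¹ 1ℚ
  ^-nonNeg {a} 0≤a (suc n) = subst (ℚ._≤ a ℚ.* a ^ℚ n) (ℚ.*-zeroʳ a)
    (ℚ.*-monoˡ-≤-nonNeg a {{ℚ.nonNegative 0≤a}} (^-nonNeg 0≤a n))

  *-mono-≤ : ∀ {a b c d} → 0ℚ ℚ.≤ a → 0ℚ ℚ.≤ d →
             a ℚ.≤ b → c ℚ.≤ d → a ℚ.* c ℚ.≤ b ℚ.* d
  *-mono-≤ {a} {d = d} 0≤a 0≤d a≤b c≤d = ℚ.≤-trans
    (ℚ.*-monoˡ-≤-nonNeg a {{ℚ.nonNegative 0≤a}} c≤d)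
    (ℚ.*-monoʳ-≤-nonNeg d {{ℚ.nonNegative 0≤d}} a≤b)

  ^-mono-≤ : ∀ {a b} → 0ℚ ℚ.≤ a → a ℚ.≤ b → ∀ n → a ^ℚ n ℚ.≤ b ^ℚ n
  ^-mono-≤ 0≤a a≤b zero    = ℚ.≤-refl
  ^-mono-≤ 0≤a a≤b (suc n) =
    *-mono-≤ 0≤a (^-nonNeg (ℚ.≤-trans 0≤a a≤b) n) a≤b (^-mono-≤ 0≤a a≤b n)

  ^-pos : ∀ {a} → 0ℚ ℚ.< a → ∀ n → 0ℚ ℚ.< a ^ℚ n
  ^-pos 0<a zero = ℚ.positive⁻¹ 1ℚ
  ^-pos {a} 0<a (suc n) = subst (ℚ._< a ℚ.* a ^ℚ n) (ℚ.*-zeroʳ a)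
    (ℚ.*-monoʳ-<-pos a {{ℚ.positive 0<a}} (^-pos 0<a n))

  ^-mono-< : ∀ {a b} → 0ℚ ℚ.≤ a → a ℚ.< b → ∀ n → a ^ℚ suc n ℚ.< b ^ℚ suc n
  ^-mono-< {a} {b} 0≤a a<b n = ℚ.≤-<-trans
    (ℚ.*-monoˡ-≤-nonNeg a {{ℚ.nonNegative 0≤a}}
      (^-mono-≤ 0≤a (ℚ.<⇒≤ a<b) n))
    (ℚ.*-monoˡ-<-pos (b ^ℚ n)
      {{ℚ.positive (^-pos (ℚ.≤-<-trans 0≤a a<b) n)}} a<b)

  1≤^ : ∀ {a} → 1ℚ ℚ.≤ a → ∀ n → 1ℚ ℚ.≤ a ^ℚ n
  1≤^ 1≤a zero = ℚ.≤-refl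
  1≤^ {a} 1≤a (suc n) = subst (ℚ._≤ a ℚ.* a ^ℚ n) (ℚ.*-identityˡ 1ℚ)
    (*-mono-≤ (ℚ.nonNegative⁻¹ 1ℚ)
      (ℚ.≤-trans (ℚ.nonNegative⁻¹ 1ℚ) (1≤^ 1≤a n)) 1≤a (1≤^ 1≤a n))

  ^-monoʳ-≤ : ∀ {a} → 1ℚ ℚ.≤ a → ∀ {m n} → m ℕ.≤ n → a ^ℚ m ℚ.≤ a ^ℚ n
  ^-monoʳ-≤ 1≤a {n = n} z≤n = 1≤^ 1≤a n
  ^-monoʳ-≤ {a} 1≤a (s≤s m≤n) = ℚ.*-monoˡ-≤-nonNeg a
    {{ℚ.nonNegative (ℚ.≤-trans (ℚ.nonNegative⁻¹ 1ℚ) 1≤a)}} (^-monoʳ-≤ 1≤a m≤n)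

  ^-assocʳ : ∀ (a : ℚ) m n → (a ^ℚ m) ^ℚ n ≡ a ^ℚ (n ℕ.* m)
  ^-assocʳ a m zero    = refl
  ^-assocʳ a m (suc n) =
    trans (cong (a ^ℚ m ℚ.*_) (^-assocʳ a m n)) (sym (^-+ m (n ℕ.* m)))
    where
    ^-+ : ∀ j k → a ^ℚ (j ℕ.+ k) ≡ a ^ℚ j ℚ.* a ^ℚ k
    ^-+ zero    k = sym (ℚ.*-identityˡ (a ^ℚ k))
    ^-+ (suc j) k = trans (cong (a ℚ.*_) (^-+ j k))
      (sym (ℚ.*-assoc a (a ^ℚ j) (a ^ℚ k)))

  /<⇒< : ∀ m n N → + m ℚ./ suc n ℚ.< + N ℚ./ 1 → m ℕ.< N ℕ.* suc n
  /<⇒< m n N lt with ℚᵘ.<-respʳ-≃ (ℚ.toℚᵘ-fromℚᵘ (mkℚᵘ (+ N) 0))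
                       (ℚᵘ.<-respˡ-≃ (ℚ.toℚᵘ-fromℚᵘ (mkℚᵘ (+ m) n))
                         (ℚ.toℚᵘ-mono-< lt))
  ... | ℚᵘ.*<* m1<N = ℤ.drop‿+<+ (subst₂ ℤ._<_
          (ℤ.*-identityʳ (+ m)) (sym (ℤ.pos-* N (suc n))) m1<N)

  ceiling : ∀ q → ∃ λ N → 1ℚ ℚ.≤ + N ℚ./ 1 × q ℚ.≤ + N ℚ./ 1
  ceiling q@(ℚ.mkℚ n d-1 _) = N , lemma 1ℚ (s≤s z≤n) , lemma q (ℕ.n≤1+n ∣ n ∣)
    where
    N : ℕ
    N = suc ∣ n ∣

    i≤∣i∣ : ∀ i → i ℤ.≤ + ∣ i ∣
    i≤∣i∣ (+ i)    = ℤ.≤-refl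
    i≤∣i∣ -[1+ i ] = ℤ.-≤+

    lemma : ∀ p → ∣ ℚ.↥ p ∣ ℕ.≤ N → p ℚ.≤ + N ℚ./ 1
    lemma p@(ℚ.mkℚ a b-1 _) a≤N = ℚ.toℚᵘ-cancel-≤
      (ℚᵘ.≤-trans (ℚᵘ.*≤* le)
        (ℚᵘ.≤-reflexive (ℚᵘ.≃-sym (ℚ.toℚᵘ-fromℚᵘ (mkℚᵘ (+ N) 0)))))
      where
      le : a ℤ.* 1ℤ ℤ.≤ + N ℤ.* + suc b-1
      le = ℤ.≤-trans (ℤ.≤-reflexive (ℤ.*-identityʳ a))
        (ℤ.≤-trans (i≤∣i∣ a)
          (ℤ.≤-trans (ℤ.+≤+ (ℕ.≤-trans a≤N (ℕ.m≤m*n N (suc b-1))))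
            (ℤ.≤-reflexive (ℤ.pos-* N (suc b-1)))))

  ∌-up : ∀ (x : ℝ) {p q} → p ℚ.≤ q → ¬ (x ∋ p) → ¬ (x ∋ q)
  ∌-up x {p} {q} p≤q x∌p x∋q with p ℚ.<? q
  ... | yes p<q = x∌p (ℝ.down x p<q x∋q)
  ... | no  p≮q = x∌p (subst (x ∋_) (ℚ.≤-antisym (ℚ.≮⇒≥ p≮q) p≤q) x∋q)

  0<⇒∃pos : ∀ (x : ℝ) → 0ᴿ <ᴿ x → ∃ λ q → 0ℚ ℚ.< q × x ∋ q
  0<⇒∃pos x (p , p≮0 , x∋p) =
    let q , p<q , x∋q = ℝ.open-up x x∋p
    in  q , ℚ.≤-<-trans (ℚ.≮⇒≥ p≮0) p<q , x∋q

-- A rational p ≥ 0 is a lower bound of x ^ δ (with x , δ > 0) as soon as it is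
-- at most y ^ (m / n) and y ^ (k / n), for some rational 0 < y < x and some
-- m / n < δ ≤ k / n.  Both exponents are needed: r ↦ y ^ r is increasing for
-- y ≥ 1 but decreasing for y ≤ 1.  The supremum of all these p is x ^ δ.
record PowerBound (x δ : ℝ) (p : ℚ) : Set where
  field
    y         : ℚ
    m k n-1   : ℕ
    0≤p       : 0ℚ ℚ.≤ p
    0<y       : 0ℚ ℚ.< y
    y<x       : x ∋ y
    m/n<δ     : δ ∋ (+ m ℚ./ suc n-1)
    δ≤k/n     : ¬ (δ ∋ (+ k ℚ./ suc n-1))
    p^n≤y^m   : p ^ℚ suc n-1 ℚ.≤ y ^ℚ m
    p^n≤y^k   : p ^ℚ suc n-1 ℚ.≤ y ^ℚ k

pow : (x δ : ℝ) → 0ᴿ <ᴿ x → 0ᴿ <ᴿ δ → ℝ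
pow x δ 0<x 0<δ = record
  { _∋_       = λ q → ∃ λ p → q ℚ.< p × PowerBound x δ p
  ; inhabited = ℚ.- 1ℚ , 0ℚ , ℚ.negative⁻¹ (ℚ.- 1ℚ) , zeroBound
  ; bounded   = W ^ℚ N , unreachable
  ; down      = λ { q<r (p , r<p , b) → p , ℚ.<-trans q<r r<p , b }
  ; open-up   = λ { (p , q<p , b) →
                    let r , q<r , r<p = ℚ.<-dense q<p in r , q<r , p , r<p , b }
  }
  where
  N M : ℕ
  N = proj₁ (ceiling (proj₁ (ℝ.bounded δ)))
  M = proj₁ (ceiling (proj₁ (ℝ.bounded x)))

  W : ℚ
  W = + M ℚ./ 1

  1≤W : 1ℚ ℚ.≤ W
  1≤W = proj₁ (proj₂ (ceiling (proj₁ (ℝ.bounded x))))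

  x∌W : ¬ (x ∋ W)
  x∌W = ∌-up x (proj₂ (proj₂ (ceiling (proj₁ (ℝ.bounded x)))))
               (proj₂ (ℝ.bounded x))

  δ∌N : ¬ (δ ∋ (+ N ℚ./ 1))
  δ∌N = ∌-up δ (proj₂ (proj₂ (ceiling (proj₁ (ℝ.bounded δ)))))
               (proj₂ (ℝ.bounded δ))

  zeroBound : PowerBound x δ 0ℚ
  zeroBound = record
    { y = y ; m = 0 ; k = N ; n-1 = 0
    ; 0≤p = ℚ.≤-refl ; 0<y = 0<y ; y<x = x∋y
    ; m/n<δ = let _ , 0<d , δ∋d = 0<⇒∃pos δ 0<δ in ℝ.down δ 0<d δ∋d
    ; δ≤k/n = δ∌N
    ; p^n≤y^m = ℚ.nonNegative⁻¹ 1ℚ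
    ; p^n≤y^k = ^-nonNeg (ℚ.<⇒≤ 0<y) N
    }
    where
    y   = proj₁ (0<⇒∃pos x 0<x)
    0<y = proj₁ (proj₂ (0<⇒∃pos x 0<x))
    x∋y = proj₂ (proj₂ (0<⇒∃pos x 0<x))

  unreachable : ¬ (∃ λ p → W ^ℚ N ℚ.< p × PowerBound x δ p)
  unreachable (p , W^N<p , b) = ℚ.<-irrefl refl (ℚ.<-≤-trans
    (^-mono-< (^-nonNeg (ℚ.≤-trans (ℚ.nonNegative⁻¹ 1ℚ) 1≤W) N) W^N<p n-1)
    (ℚ.≤-trans p^n≤y^m
      (ℚ.≤-trans (^-mono-≤ (ℚ.<⇒≤ 0<y) y≤W m)
        (ℚ.≤-trans (^-monoʳ-≤ 1≤W m≤nN)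
          (ℚ.≤-reflexive (sym (^-assocʳ W N (suc n-1))))))))
    where
    open PowerBound b
    y≤W : y ℚ.≤ W
    y≤W = ℚ.≮⇒≥ λ W<y → x∌W (ℝ.down x W<y y<x)
    m≤nN : m ℕ.≤ suc n-1 ℕ.* N
    m≤nN = subst (m ℕ.≤_) (ℕ.*-comm N (suc n-1))
      (ℕ.<⇒≤ (/<⇒< m n-1 N
        (ℚ.≰⇒> λ N≤m/n → ∌-up δ N≤m/n δ∌N m/n<δ)))

-- F is the graph of a ℚ-valued function of a real variable x > 0.  Double
-- negation is the constructive form of "F is defined at x": comparison of
-- real numbers is undecidable, so no value can be computed from x.
TendsTo : (F : (x : ℝ) → 0ᴿ <ᴿ x → ℚ → Set) → ℚ → Set₁
TendsTo F L =
  ∀ (ε : ℝ) → 0ᴿ <ᴿ ε →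
  ∃ λ (X : ℝ) → ∀ (x : ℝ) (0<x : 0ᴿ <ᴿ x) → X ≤ᴿ x →
    ¬ ¬ (∃ λ v → F x 0<x v) ×
    (∀ v → F x 0<x v → fromℚ ℚ.∣ v ℚ.- L ∣ <ᴿ ε)

HasCardinality : {A : Set} → (A → Set) → ℕ → Set
HasCardinality {A} P n =
  ∃ λ (xs : List A) → Unique xs × (∀ a → a ∈ xs ⇔ P a) × length xs ≡ n

module PowerSeries {c e} (R : CommutativeRing c e) where

  open CommutativeRing R
  open RawSemiringDefs (Semiring.rawSemiring semiring) public using (sum; _^_; _∣_)

  Series : Set c
  Series = ℕ → Carrier

  infix  4 _≈ₛ_
  infixl 6 _-ₛ_
  infixl 7 _*ₛ_
  infixr 8 _·ₛ_

  _≈ₛ_ : Series → Series → Set e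
  f ≈ₛ g = ∀ n → f n ≈ g n

  constant : Carrier → Series
  constant a zero    = a
  constant a (suc _) = 0#

  _-ₛ_ : Series → Series → Series
  (f -ₛ g) n = f n - g n

  _·ₛ_ : Carrier → Series → Series
  (a ·ₛ f) n = a * f n

  _*ₛ_ : Series → Series → Series
  (f *ₛ g) n = sum {suc n} λ i → f (toℕ i) * g (n ℕ.∸ toℕ i)

  ∑ₛ : ∀ {t} → Vector Series t → Series
  ∑ₛ fs n = sum λ j → fs j n

  IsUnit : Series → Set (c ⊔ˡ e)
  IsUnit u = ∃ λ v → u *ₛ v ≈ₛ constant 1#

  -- Relative to an element ℓ of R.
  record IsDistinguished (ℓ : Carrier) (g : Series) (d : ℕ) : Set (c ⊔ˡ e) where
    field
      monic    : g d ≈ 1#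
      degree   : ∀ n → d ℕ.< n → g n ≈ 0#
      nonLeading : ∀ n → n ℕ.< d → ℓ ∣ g n

  record WeierstrassFactorization (ℓ : Carrier) (f : Series) : Set (c ⊔ˡ e) where
    field
      μ             : ℕ
      deg           : ℕ
      g u           : Series
      distinguished : IsDistinguished ℓ g deg
      unit          : IsUnit u
      factorization : f ≈ₛ (ℓ ^ μ) ·ₛ (g *ₛ u)

------------------------------------------------------------------------
-- The ring of ℓ-adic integers, as the inverse limit of the ℤ / ℓᵏ

module Padic (ℓ : ℕ) where

  infix 4 _≡_[modℓ^_]

  record _≡_[modℓ^_] (a b : ℤ) (k : ℕ) : Set where
    constructor mod
    field divs : + (ℓ ℕ.^ k) ℤ.∣ a ℤ.- b

  open _≡_[modℓ^_] public

  private
    ≡⇒mod : ∀ {a b} k → a ≡ b → a ≡ b [modℓ^ k ]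
    ≡⇒mod {a} k refl = mod (divides 0ℤ (ℤ.+-inverseʳ a))

    mod-sym : ∀ {a b} k → a ≡ b [modℓ^ k ] → b ≡ a [modℓ^ k ]
    mod-sym {a} {b} k (mod a≡b) =
      mod (subst (+ (ℓ ℕ.^ k) ℤ.∣_) (eq a b) (ℤ.∣m⇒∣-m a≡b))
      where
      eq : ∀ a b → ℤ.- (a ℤ.- b) ≡ b ℤ.- a
      eq = solve-∀

    mod-trans : ∀ {a b c} k → a ≡ b [modℓ^ k ] → b ≡ c [modℓ^ k ] →
                a ≡ c [modℓ^ k ]
    mod-trans {a} {b} {c} k (mod a≡b) (mod b≡c) =
      mod (subst (+ (ℓ ℕ.^ k) ℤ.∣_) (eq a b c) (ℤ.∣m∣n⇒∣m+n a≡b b≡c))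
      where
      eq : ∀ a b c → (a ℤ.- b) ℤ.+ (b ℤ.- c) ≡ a ℤ.- c
      eq = solve-∀

    mod-+ : ∀ {a b c d} k → a ≡ b [modℓ^ k ] → c ≡ d [modℓ^ k ] →
            a ℤ.+ c ≡ b ℤ.+ d [modℓ^ k ]
    mod-+ {a} {b} {c} {d} k (mod a≡b) (mod c≡d) =
      mod (subst (+ (ℓ ℕ.^ k) ℤ.∣_) (eq a b c d) (ℤ.∣m∣n⇒∣m+n a≡b c≡d))
      where
      eq : ∀ a b c d → (a ℤ.- b) ℤ.+ (c ℤ.- d) ≡ (a ℤ.+ c) ℤ.- (b ℤ.+ d)
      eq = solve-∀

    mod-neg : ∀ {a b} k → a ≡ b [modℓ^ k ] → ℤ.- a ≡ ℤ.- b [modℓ^ k ]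
    mod-neg {a} {b} k (mod a≡b) =
      mod (subst (+ (ℓ ℕ.^ k) ℤ.∣_) (eq a b) (ℤ.∣m⇒∣-m a≡b))
      where
      eq : ∀ a b → ℤ.- (a ℤ.- b) ≡ ℤ.- a ℤ.- ℤ.- b
      eq = solve-∀

    mod-* : ∀ {a b c d} k → a ≡ b [modℓ^ k ] → c ≡ d [modℓ^ k ] →
            a ℤ.* c ≡ b ℤ.* d [modℓ^ k ]
    mod-* {a} {b} {c} {d} k (mod a≡b) (mod c≡d) =
      mod (subst (+ (ℓ ℕ.^ k) ℤ.∣_) (eq a b c d)
        (ℤ.∣m∣n⇒∣m+n (ℤ.∣m⇒∣m*n c a≡b) (ℤ.∣n⇒∣m*n b c≡d)))
      where
      eq : ∀ a b c d → (a ℤ.- b) ℤ.* c ℤ.+ b ℤ.* (c ℤ.- d) ≡ a ℤ.* c ℤ.- b ℤ.* d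
      eq = solve-∀

    mod-weaken : ∀ {a b} j k → a ≡ b [modℓ^ j ℕ.+ k ] → a ≡ b [modℓ^ j ]
    mod-weaken j k (mod a≡b) = mod (ℤ.∣-trans
      (divides (+ (ℓ ℕ.^ k))
        (trans (cong +_ (trans (ℕ.^-distribˡ-+-* ℓ j k)
                               (ℕ.*-comm (ℓ ℕ.^ j) (ℓ ℕ.^ k))))
               (ℤ.pos-* (ℓ ℕ.^ k) (ℓ ℕ.^ j)))) a≡b)

  -- approx k represents the residue modulo ℓᵏ.
  record ℤℓ : Set where
    field
      approx   : ℕ → ℤ
      coherent : ∀ k → approx (suc k) ≡ approx k [modℓ^ k ]

  open ℤℓ public

  infix 4 _≈_
  record _≈_ (a b : ℤℓ) : Set where
    constructor mk≈
    field at : ∀ k → approx a k ≡ approx b k [modℓ^ k ]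

  open _≈_ public

  approx-+ : ∀ (a : ℤℓ) k j → approx a (k ℕ.+ j) ≡ approx a k [modℓ^ k ]
  approx-+ a k zero    =
    ≡⇒mod k (cong (approx a) (ℕ.+-identityʳ k))
  approx-+ a k (suc j) = mod-trans k
    (mod-weaken k j (subst (λ i → approx a i ≡ approx a (k ℕ.+ j) [modℓ^ k ℕ.+ j ])
      (sym (ℕ.+-suc k j)) (coherent a (k ℕ.+ j))))
    (approx-+ a k j)

  fromℤ : ℤ → ℤℓ
  fromℤ i = record { approx = λ _ → i ; coherent = λ k → ≡⇒mod k refl }

  _+ℓ_ _*ℓ_ : ℤℓ → ℤℓ → ℤℓ
  a +ℓ b = record
    { approx   = λ k → approx a k ℤ.+ approx b k
    ; coherent = λ k → mod-+ k (coherent a k) (coherent b k) }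
  a *ℓ b = record
    { approx   = λ k → approx a k ℤ.* approx b k
    ; coherent = λ k → mod-* k (coherent a k) (coherent b k) }

  -ℓ_ : ℤℓ → ℤℓ
  -ℓ a = record
    { approx   = λ k → ℤ.- approx a k
    ; coherent = λ k → mod-neg k (coherent a k) }

  ℤℓ-ring : CommutativeRing 0ℓ 0ℓ
  ℤℓ-ring = record
    { Carrier = ℤℓ
    ; _≈_ = _≈_
    ; _+_ = _+ℓ_
    ; _*_ = _*ℓ_
    ; -_  = -ℓ_
    ; 0#  = fromℤ 0ℤ
    ; 1#  = fromℤ 1ℤ
    ; isCommutativeRing = record
      { isRing = record
        { +-isAbelianGroup = record
          { isGroup = record
            { isMonoid = record
              { isSemigroup = record
                { isMagma = record
                  { isEquivalence = record
                    { refl  = pw λ k → refl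
                    ; sym   = λ p → mk≈ λ k → mod-sym k (at p k)
                    ; trans = λ p q → mk≈ λ k → mod-trans k (at p k) (at q k)
                    }
                  ; ∙-cong = λ p q → mk≈ λ k → mod-+ k (at p k) (at q k)
                  }
                ; assoc = λ a b c → pw λ k →
                    ℤ.+-assoc (approx a k) (approx b k) (approx c k)
                }
              ; identity = (λ a → pw λ k → ℤ.+-identityˡ (approx a k))
                         , (λ a → pw λ k → ℤ.+-identityʳ (approx a k))
              }
            ; inverse = (λ a → pw λ k → ℤ.+-inverseˡ (approx a k))
                      , (λ a → pw λ k → ℤ.+-inverseʳ (approx a k))
            ; ⁻¹-cong = λ p → mk≈ λ k → mod-neg k (at p k)
            }
          ; comm = λ a b → pw λ k → ℤ.+-comm (approx a k) (approx b k)
          }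
        ; *-cong  = λ p q → mk≈ λ k → mod-* k (at p k) (at q k)
        ; *-assoc = λ a b c → pw λ k →
            ℤ.*-assoc (approx a k) (approx b k) (approx c k)
        ; *-identity = (λ a → pw λ k → ℤ.*-identityˡ (approx a k))
                     , (λ a → pw λ k → ℤ.*-identityʳ (approx a k))
        ; distrib =
            (λ a b c → pw λ k →
              ℤ.*-distribˡ-+ (approx a k) (approx b k) (approx c k))
          , (λ a b c → pw λ k →
              ℤ.*-distribʳ-+ (approx a k) (approx b k) (approx c k))
        }
      ; *-comm = λ a b → pw λ k → ℤ.*-comm (approx a k) (approx b k)
      }
    }
    where
    pw : ∀ {a b} → (∀ k → approx a k ≡ approx b k) → a ≈ b
    pw eq = mk≈ λ k → ≡⇒mod k (eq k)

  -- b (b - 1) ⋯ (b - n + 1)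
  fallingℤ : ℤ → ℕ → ℤ
  fallingℤ b zero    = 1ℤ
  fallingℤ b (suc n) = fallingℤ b n ℤ.* (b ℤ.- + n)

  falling : ℤℓ → ℕ → ℤℓ
  falling b zero    = fromℤ 1ℤ
  falling b (suc n) = falling b n *ℓ (b +ℓ (-ℓ fromℤ (+ n)))

  private
    falling-mod : ∀ {a b} k n → a ≡ b [modℓ^ k ] →
                  fallingℤ a n ≡ fallingℤ b n [modℓ^ k ]
    falling-mod k zero    a≡b = ≡⇒mod k refl
    falling-mod k (suc n) a≡b = mod-* k (falling-mod k n a≡b)
      (mod-+ k a≡b (≡⇒mod k refl))

    approx-falling : ∀ b n k → approx (falling b n) k ≡ fallingℤ (approx b k) n
    approx-falling b zero    k = refl
    approx-falling b (suc n) k =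
      cong (ℤ._* (approx b k ℤ.- + n)) (approx-falling b n k)

    falling-shift : ∀ a n → fallingℤ (1ℤ ℤ.+ a) (suc n) ≡
                            (1ℤ ℤ.+ a) ℤ.* fallingℤ a n
    falling-shift a zero    = eq a
      where
      eq : ∀ a → 1ℤ ℤ.* (1ℤ ℤ.+ a ℤ.- 0ℤ) ≡ (1ℤ ℤ.+ a) ℤ.* 1ℤ
      eq = solve-∀
    falling-shift a (suc n) = trans
      (cong (ℤ._* (1ℤ ℤ.+ a ℤ.- + suc n)) (falling-shift a n))
      (trans (cong (λ z → (1ℤ ℤ.+ a) ℤ.* fallingℤ a n ℤ.* z) (shift a (+ n)))
             (ℤ.*-assoc (1ℤ ℤ.+ a) (fallingℤ a n) (a ℤ.- + n)))
      where
      shift : ∀ a m → 1ℤ ℤ.+ a ℤ.- (1ℤ ℤ.+ m) ≡ a ℤ.- m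
      shift = solve-∀

    falling-Δ : ∀ a n → fallingℤ (1ℤ ℤ.+ a) (suc n) ≡
                        fallingℤ a (suc n) ℤ.+ + suc n ℤ.* fallingℤ a n
    falling-Δ a n = trans (falling-shift a n) (eq a (fallingℤ a n) (+ n))
      where
      eq : ∀ a f m → (1ℤ ℤ.+ a) ℤ.* f ≡ f ℤ.* (a ℤ.- m) ℤ.+ (1ℤ ℤ.+ m) ℤ.* f
      eq = solve-∀

    falling-0 : ∀ n → fallingℤ 0ℤ (suc n) ≡ 0ℤ
    falling-0 zero    = refl
    falling-0 (suc n) = cong (ℤ._* (0ℤ ℤ.- + suc n)) (falling-0 n)

    ℤ-ind : (P : ℤ → Set) → P 0ℤ → (∀ a → P a → P (1ℤ ℤ.+ a)) →
            (∀ a → P (1ℤ ℤ.+ a) → P a) → ∀ a → P a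
    ℤ-ind P base up dn (+ zero)        = base
    ℤ-ind P base up dn (+ suc n)       = up (+ n) (ℤ-ind P base up dn (+ n))
    ℤ-ind P base up dn -[1+ zero ]     = dn -[1+ 0 ] base
    ℤ-ind P base up dn -[1+ suc n ]    =
      dn -[1+ suc n ] (ℤ-ind P base up dn -[1+ n ])

    !∣falling : ∀ n a → + (n !) ℤ.∣ fallingℤ a n
    !∣falling zero    a = divides 1ℤ refl
    !∣falling (suc n) = ℤ-ind (λ a → + (suc n !) ℤ.∣ fallingℤ a (suc n))
      (divides 0ℤ (falling-0 n))
      (λ a d → subst (+ (suc n !) ℤ.∣_) (sym (falling-Δ a n))
                 (ℤ.∣m∣n⇒∣m+n d (step a)))
      (λ a d → ℤ.∣m+n∣n⇒∣m {m = fallingℤ a (suc n)}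
                 (subst (+ (suc n !) ℤ.∣_) (falling-Δ a n) d) (step a))
      where
      step : ∀ a → + (suc n !) ℤ.∣ + suc n ℤ.* fallingℤ a n
      step a = subst (ℤ._∣ + suc n ℤ.* fallingℤ a n) (sym (ℤ.pos-* (suc n) (n !)))
        (ℤ.*-monoʳ-∣ (+ suc n) (!∣falling n a))

  -- The division is exact (!*binomialℤ below).
  binomialℤ : ℤ → ℕ → ℤ
  binomialℤ b n = (fallingℤ b n ℤ./ℕ (n !)) {{n ℕ.!≢0}}

  !*binomialℤ : ∀ b n → + (n !) ℤ.* binomialℤ b n ≡ fallingℤ b n
  !*binomialℤ b n = exact (!∣falling n b)
    where
    instance _ = n ℕ.!≢0
    F : ℤ
    F = fallingℤ b n
    r : ℕ
    r = F ℤ.%ℕ (n !)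
    split : F ≡ + r ℤ.+ binomialℤ b n ℤ.* + (n !)
    split = ℤ.a≡a%ℕn+[a/ℕn]*n F (n !)
    exact : + (n !) ℤ.∣ F → + (n !) ℤ.* binomialℤ b n ≡ F
    exact n!∣F with r in r≡ | ℤ.n%ℕd<d F (n !) | split
    ... | zero  | _   | eq = trans (ℤ.*-comm (+ (n !)) (binomialℤ b n))
                               (sym (trans eq (ℤ.+-identityˡ _)))
    ... | suc s | s<n | eq = ⊥-elim (ℕ.>⇒∤ s<n (ℤ.∣⇒∣ᵤ
            (ℤ.∣m+n∣n⇒∣m {m = + suc s} (subst (+ (n !) ℤ.∣_) eq n!∣F)
              (divides (binomialℤ b n) refl))))

  module _ (ℓ-prime : Prime ℓ) where

    private
      instance
        ℓ≢0 : ℕ.NonZero ℓ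
        ℓ≢0 = prime⇒nonZero ℓ-prime

      1<ℓ : 1 ℕ.< ℓ
      1<ℓ = ℕ.nonTrivial⇒n>1 ℓ {{prime⇒nonTrivial ℓ-prime}}

      n<ℓ^n : ∀ n → n ℕ.< ℓ ℕ.^ n
      n<ℓ^n zero    = s≤s z≤n
      n<ℓ^n (suc n) = ℕ.≤-<-trans (n<ℓ^n n)
        (subst (ℓ ℕ.^ n ℕ.<_) (ℕ.*-comm (ℓ ℕ.^ n) ℓ)
          (ℕ.m<m*n (ℓ ℕ.^ n) ℓ {{ℕ.m^n≢0 ℓ n}} 1<ℓ))

      cancel-∤ : ∀ j m d → ¬ (ℓ ℕ.∣ m) → ℓ ℕ.^ j ℕ.∣ m ℕ.* d → ℓ ℕ.^ j ℕ.∣ d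
      cancel-∤ zero    m d ℓ∤m _  = ℕ.1∣ d
      cancel-∤ (suc j) m d ℓ∤m dv
        with euclidsLemma m d ℓ-prime (ℕ.∣-trans (ℕ.m∣m*n (ℓ ℕ.^ j)) dv)
      ... | inj₁ ℓ∣m = ⊥-elim (ℓ∤m ℓ∣m)
      ... | inj₂ (ℕ.divides q refl) = subst (ℓ ℕ.^ suc j ℕ.∣_) (ℕ.*-comm ℓ q)
              (ℕ.*-monoʳ-∣ ℓ (cancel-∤ j m q ℓ∤m
                (ℕ.*-cancelˡ-∣ ℓ (subst (ℓ ℕ.^ suc j ℕ.∣_) eq dv))))
        where
        eq : m ℕ.* (q ℕ.* ℓ) ≡ ℓ ℕ.* (m ℕ.* q)
        eq = trans (sym (ℕ.*-assoc m q ℓ)) (ℕ.*-comm (m ℕ.* q) ℓ)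

      cancelℕ : ∀ k e m d → .{{ℕ.NonZero m}} → m ℕ.< ℓ ℕ.^ e →
                ℓ ℕ.^ (k ℕ.+ e) ℕ.∣ m ℕ.* d → ℓ ℕ.^ k ℕ.∣ d
      cancelℕ k zero    (suc m) d (s≤s ()) dv
      cancelℕ k (suc e) m d m<ℓ^e dv with ℓ ℕ.∣? m
      ... | no  ℓ∤m = ℕ.∣-trans
              (subst (ℓ ℕ.^ k ℕ.∣_) (sym (ℕ.^-distribˡ-+-* ℓ k (suc e)))
                (ℕ.m∣m*n (ℓ ℕ.^ suc e)))
              (cancel-∤ (k ℕ.+ suc e) m d ℓ∤m dv)
      ... | yes (ℕ.divides q refl) =
              cancelℕ k e q d {{q≢0}} q<ℓ^e
                (ℕ.*-cancelˡ-∣ ℓ (subst₂ ℕ._∣_ (cong (ℓ ℕ.^_) (ℕ.+-suc k e)) eq dv))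
        where
        q≢0 : ℕ.NonZero q
        q≢0 = ℕ.m*n≢0⇒m≢0 q
        q<ℓ^e : q ℕ.< ℓ ℕ.^ e
        q<ℓ^e = ℕ.*-cancelˡ-< ℓ q (ℓ ℕ.^ e)
          (subst (ℕ._< ℓ ℕ.* ℓ ℕ.^ e) (ℕ.*-comm q ℓ) m<ℓ^e)
        eq : q ℕ.* ℓ ℕ.* d ≡ ℓ ℕ.* (q ℕ.* d)
        eq = trans (cong (ℕ._* d) (ℕ.*-comm q ℓ)) (ℕ.*-assoc ℓ q d)

      cancel! : ∀ k n {a b} →
        + (n !) ℤ.* a ≡ + (n !) ℤ.* b [modℓ^ k ℕ.+ n ! ] → a ≡ b [modℓ^ k ]
      cancel! k n {a} {b} (mod dv) = mod (ℤ.∣ᵤ⇒∣ (cancelℕ k (n !) (n !) ∣ a ℤ.- b ∣ {{n ℕ.!≢0}}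
        (n<ℓ^n (n !))
        (subst (ℓ ℕ.^ (k ℕ.+ n !) ℕ.∣_)
          (trans (cong ∣_∣ (eq (+ (n !)) a b)) (ℤ.abs-* (+ (n !)) (a ℤ.- b)))
          (ℤ.∣⇒∣ᵤ dv))))
        where
        eq : ∀ f a b → f ℤ.* a ℤ.- f ℤ.* b ≡ f ℤ.* (a ℤ.- b)
        eq = solve-∀

    -- The residue of b modulo ℓ ^ (k + n!) determines binom b n modulo ℓ ^ k,
    -- because ℓ ^ (n!) > n!, so that dividing by n! loses at most n! digits.
    binomial : ℤℓ → ℕ → ℤℓ
    binomial b n = record
      { approx   = λ k → binomialℤ (approx b (k ℕ.+ n !)) n
      ; coherent = λ k → cancel! k n
          (subst₂ (λ x y → x ≡ y [modℓ^ k ℕ.+ n ! ])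
            (sym (!*binomialℤ (approx b (suc k ℕ.+ n !)) n))
            (sym (!*binomialℤ (approx b (k ℕ.+ n !)) n))
            (falling-mod (k ℕ.+ n !) n (coherent b (k ℕ.+ n !))))
      }

    !*binomial : ∀ b n → fromℤ (+ (n !)) *ℓ binomial b n ≈ falling b n
    !*binomial b n = mk≈ λ k → mod-trans k
      (≡⇒mod k (!*binomialℤ (approx b (k ℕ.+ n !)) n))
      (mod-trans k (falling-mod k n (approx-+ b k (n !)))
        (≡⇒mod k (sym (approx-falling b n k))))

    open PowerSeries ℤℓ-ring public

    [1+T]^_ : ℤℓ → Series
    [1+T]^ b = binomial b

    characteristicSeries : ∀ {t} → Vector ℤℓ t → Series
    characteristicSeries α = ∑ₛ λ j →
      constant (fromℤ (+ 2)) -ₛ [1+T]^ (α j) -ₛ [1+T]^ (-ℓ α j)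

    -- (m , l) is the pair (μ , λ) of the bouquet of t loops with voltage α; the
    -- Weierstrass factorization is unique, so it does not matter which one is used.
    HasIwasawaInvariants : ∀ {t} → Vector ℤℓ t → ℕ → ℤ → Set
    HasIwasawaInvariants α m l =
      Σ (WeierstrassFactorization (fromℤ (+ ℓ)) (characteristicSeries α)) λ w →
        let open WeierstrassFactorization w in
        μ ≡ m × + deg ℤ.- 1ℤ ≡ l

VoltageAssignment : Set
VoltageAssignment = Σ ℕ (Vec ℤ)

maxNorm : ∀ {t} → Vec ℤ t → ℕ
maxNorm α = Vec.foldr′ ℕ._⊔_ 0 (Vec.map ∣_∣ α)

module Counting (ℓ : ℕ) (ℓ-prime : Prime ℓ) (δ : ℝ) (0<δ : 0ᴿ <ᴿ δ) where

  open Padic ℓ using (fromℤ; HasIwasawaInvariants)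

  𝒜 : (x : ℝ) → 0ᴿ <ᴿ x → VoltageAssignment → Set
  𝒜 x 0<x (t , α) =
    2 ℕ.≤ t ×
    fromℕ t ≤ᴿ pow x δ 0<x 0<δ ×
    fromℕ (maxNorm α) ≤ᴿ x ×
    (∃ λ i → ¬ (+ ℓ ℤ.∣ Vec.lookup α i))

  𝒯 : ℕ → ℤ → (x : ℝ) → 0ᴿ <ᴿ x → VoltageAssignment → Set
  𝒯 m l x 0<x (t , α) =
    𝒜 x 0<x (t , α) ×
    HasIwasawaInvariants ℓ-prime (λ j → fromℤ (Vec.lookup α j)) m l

  Proportion : ℕ → ℤ → (x : ℝ) → 0ᴿ <ᴿ x → ℚ → Set
  Proportion m l x 0<x v =
    ∃ λ #𝒯 → ∃ λ #𝒜 → Σ (ℕ.NonZero #𝒜) λ #𝒜≢0 →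
      HasCardinality (𝒯 m l x 0<x) #𝒯 ×
      HasCardinality (𝒜 x 0<x) #𝒜 ×
      v ≡ (+ #𝒯 ℚ./ #𝒜) {{#𝒜≢0}}

1-1/ : (ℓ : ℕ) → Prime ℓ → ℚ
1-1/ ℓ ℓ-prime = 1ℚ ℚ.- (1ℤ ℚ./ ℓ) {{prime⇒nonZero ℓ-prime}}

{-# OPTIONS --safe #-}

-- Since (1 + T)^a + (1 + T)^-a = 2 + a² T² + ⋯, the characteristic series is
-- -(α₁² + ⋯ + αₜ²) T² + ⋯.  If ℓ does not divide s = α₁² + ⋯ + αₜ², it is T² times
-- a unit, so μ = 0 and λ = 1; conversely a distinguished factor of degree 2 with
-- μ = 0 makes the coefficient of T² a unit.  So one has to count the α with ℓ ∤ s.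
--
-- The residue of s modulo ℓ performs a random walk with t steps a², a ∈ [-N, N].
-- A step is 0, and also 1, with probability at least 1/2ℓ, so ℓ - 1 steps
-- reach every residue with probability bounded below: the walk contracts
-- towards the uniform distribution at a rate independent of N.  The boxes
-- [-N, N]ᵗ grow so fast with t that only the largest t matters; as this t and N
-- both tend to infinity, ℓ ∣ s has limiting probability 1/ℓ, while the vectors
-- in (ℓℤ)ᵗ become negligible.

module Submission where

open import Defs
open import Algebra.Bundles using (CommutativeRing)
import Algebra.Definitions.RawMagma as RawMagmaDefs
open import Data.Fin.Base using (Fin; zero; suc; toℕ)
open import Data.Fin.Properties using (any?)
open import Data.Integer.Base as ℤ using (ℤ; +_; -[1+_]; 0ℤ; 1ℤ; ∣_∣)
import Data.Integer.DivMod as ℤ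
open import Data.Integer.Divisibility.Signed as ℤ using (divides)
import Data.Integer.Properties as ℤ
import Data.Integer.Tactic.RingSolver as ℤ-Solver
open import Data.List.Base using (List; []; _∷_; _++_; map; length; filter; downFrom; cartesianProductWith)
open import Data.List.Membership.Propositional using (_∈_)
open import Data.List.Membership.Propositional.Properties
open import Data.List.Membership.Propositional.Properties.WithK using (unique∧set⇒bag)
open import Data.List.Properties using (length-map; length-downFrom)
open import Data.List.Relation.Binary.BagAndSetEquality using (∼bag⇒↭)
open import Data.List.Relation.Binary.Disjoint.Propositional using (Disjoint)
open import Data.List.Relation.Binary.Permutation.Propositional.Properties using (↭-length)
open import Data.List.Relation.Unary.All using ([]; _∷_)
open import Data.List.Relation.Unary.AllPairs using ([]; _∷_)
open import Data.List.Relation.Unary.Any using (here)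
open import Data.List.Relation.Unary.Unique.Propositional using (Unique)
import Data.List.Relation.Unary.Unique.Propositional.Properties as Unique
open import Data.Nat.Base as ℕ using (ℕ; zero; suc; NonZero; z≤n; s≤s; _!)
open import Data.Nat.Coprimality using (Coprime; coprime-Bézout)
import Data.Nat.Divisibility as ℕ
import Data.Nat.DivMod as ℕ
open import Data.Nat.GCD using (module Bézout)
import Data.Nat.ListAction as ℕ
open import Data.Nat.Primality using (Prime; prime⇒irreducible; prime⇒nonTrivial; prime⇒nonZero)
import Data.Nat.Properties as ℕ
open import Data.Nat.Tactic.RingSolver using (solve-∀)
open import Data.Product.Base using (∃; _×_; _,_; proj₁; proj₂)
open import Data.Rational.Base as ℚ using (ℚ; 0ℚ; 1ℚ)
import Data.Rational.Properties as ℚ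
open import Data.Rational.Unnormalised.Base as ℚᵘ using (mkℚᵘ; *≤*; *<*)
import Data.Rational.Unnormalised.Properties as ℚᵘ
open import Data.Sum.Base using (inj₁; inj₂)
open import Data.Unit.Base using (tt)
open import Data.Vec.Base using (Vec; []; _∷_; lookup)
open import Data.Vec.Functional using (Vector)
import Data.Vec.Properties as Vec
open import Function.Base using (_∘_)
open import Function.Bundles using (_⇔_; mk⇔; Equivalence)
open import Relation.Binary.PropositionalEquality as ≡
  using (_≡_; _≢_; cong; cong₂; subst; subst₂)
import Relation.Binary.Reasoning.Setoid as ≈-Reasoning
open import Relation.Nullary using (¬_; Dec; yes; no; contradiction)
open import Relation.Nullary.Decidable using (¬?)

-- The contraction works with one-sided bounds. If a function on residues is at most h everywhere
-- and lies g below h at some r, each step carries a share of this gap to r + 0² and to r + 1², so ℓ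
-- - 1 steps spread it over all residues. A residue with a gap always exists by averaging, because
-- the total mass over a period is known exactly; the same conservation later turns the upper bound
-- into a lower bound. All estimates are inequalities between natural numbers, with denominators
-- cleared and complements added instead of subtracted. The other obstacle is constructive: x and
-- x^δ are Dedekind cuts, so the floors that bound the entries and the number of loops cannot be
-- computed. They exist up to double negation, which is enough because both halves of `TendsTo` come
-- down to negations once a rational below ε has been chosen independently of the floors.

-- The Iwasawa invariants of a bouquet
module SeriesProperties {c e} (R : CommutativeRing c e) where

  open CommutativeRing R hiding (zero)
  open PowerSeries R
  open RawMagmaDefs (CommutativeRing.*-rawMagma R) using (_,_)
  open ≈-Reasoning setoid

  sum-cong : ∀ {n} {f g : Vector Carrier n} → (∀ i → f i ≈ g i) → sum f ≈ sum g
  sum-cong {zero}  f≈g = refl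
  sum-cong {suc n} f≈g = +-cong (f≈g zero) (sum-cong (λ i → f≈g (suc i)))

  -- `F` will be the embedding of ℤ into the ℓ-adic integers: a recursion between integers along α
  -- is transferred to a sum in the ring.
  sum-additive : (F : ℤ → Carrier) (c : ℤ → ℤ) (s : ∀ {t} → Vec ℤ t → ℤ) →
    F (s []) ≈ 0# → (∀ {t} a (α : Vec ℤ t) → F (c a) + F (s α) ≈ F (s (a ∷ α))) →
    ∀ {t} (α : Vec ℤ t) (f : Vector Carrier t) → (∀ j → f j ≈ F (c (lookup α j))) → sum f ≈ F (s α)
  sum-additive F c s s[] s∷ []      f f≈c = sym s[]
  sum-additive F c s s[] s∷ (a ∷ α) f f≈c =
    trans (+-cong (f≈c zero) (sum-additive F c s s[] s∷ α (λ j → f (suc j)) (λ j → f≈c (suc j)))) (s∷ a α)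

  sum-0* : ∀ {n} (f : Vector Carrier n) → sum (λ i → 0# * f i) ≈ 0#
  sum-0* {zero}  f = refl
  sum-0* {suc n} f = trans (+-cong (zeroˡ (f zero)) (sum-0* (λ i → f (suc i)))) (+-identityʳ 0#)

  -- The coefficients v₀, …, vₙ₋₁ of the inverse of u are kept in reverse order,
  -- since vₙ depends on all of them.
  module _ (u : Series) (w : Carrier) (u₀w≈1 : u 0 * w ≈ 1#) where

    private
      next : ∀ n → Vector Carrier n → Carrier
      next zero    _ = w
      next (suc n) v = - (w * sum λ i → u (suc (toℕ i)) * v i)

      history : ∀ n → Vector Carrier n
      history (suc n) zero    = next n (history n)
      history (suc n) (suc i) = history n i

      inverse : Series
      inverse n = next n (history n)

      history≡inverse : ∀ n (i : Fin (suc n)) → history (suc n) i ≡ inverse (n ℕ.∸ toℕ i)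
      history≡inverse n       zero    = ≡.refl
      history≡inverse (suc n) (suc i) = history≡inverse n i

      u*inverse : u *ₛ inverse ≈ₛ constant 1#
      u*inverse zero    = trans (+-identityʳ _) u₀w≈1
      u*inverse (suc n) = begin
        u 0 * - (w * t) + sum (λ (i : Fin (suc n)) → u (suc (toℕ i)) * inverse (n ℕ.∸ toℕ i))
          ≈⟨ +-congˡ (sum-cong {suc n} λ i → *-congˡ {u (suc (toℕ i))} (reflexive (≡.sym (history≡inverse n i)))) ⟩
        u 0 * - (w * t) + t
          ≈⟨ +-congʳ (sym (-‿distribʳ-* (u 0) (w * t))) ⟩
        - (u 0 * (w * t)) + t
          ≈⟨ +-congʳ (-‿cong (trans (sym (*-assoc (u 0) w t)) (trans (*-congʳ u₀w≈1) (*-identityˡ t)))) ⟩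
        - t + t
          ≈⟨ -‿inverseˡ t ⟩
        0# ∎
        where
        open import Algebra.Properties.Ring ring using (-‿distribʳ-*)
        t : Carrier
        t = sum λ (i : Fin (suc n)) → u (suc (toℕ i)) * history (suc n) i

    invertible⇒unit : IsUnit u
    invertible⇒unit = inverse , u*inverse

  T² : Series
  T² 0 = 0#
  T² 1 = 0#
  T² 2 = 1#
  T² (suc (suc (suc _))) = 0#

  T²-distinguished : ∀ ℓ → IsDistinguished ℓ T² 2
  T²-distinguished ℓ = record
    { monic      = refl
    ; degree     = λ { (suc (suc (suc _))) _ → refl ; 1 (s≤s ()) ; 2 (s≤s (s≤s ())) }
    ; nonLeading = λ { 0 _ → 0# , zeroˡ ℓ ; 1 _ → 0# , zeroˡ ℓ ; (suc (suc _)) (s≤s (s≤s ())) }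
    }

  -- Dropping the first two coefficients divides by T²; the cofactor is a unit because its constant
  -- term is `f 2`.
  T²-factorization : ∀ ℓ f → f 0 ≈ 0# → f 1 ≈ 0# → ∀ {a} → f 2 ≈ a → ∀ w → a * w ≈ 1# →
                     WeierstrassFactorization ℓ f
  T²-factorization ℓ f f₀≈0 f₁≈0 f₂≈a w aw≈1 = record
    { μ = 0 ; deg = 2 ; g = T² ; u = u
    ; distinguished = T²-distinguished ℓ
    ; unit = invertible⇒unit u w (trans (*-congʳ f₂≈a) aw≈1)
    ; factorization = λ n → trans (product n) (sym (*-identityˡ _))
    }
    where
    u : Series
    u n = f (suc (suc n))
    product : f ≈ₛ T² *ₛ u
    product 0 = trans f₀≈0 (sym (trans (+-identityʳ _) (zeroˡ _)))
    product 1 = trans f₁≈0 (sym (sum-0* {2} (λ i → u (1 ℕ.∸ toℕ i))))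
    product (suc (suc n)) = sym (begin
      0# * u (suc (suc n)) + (0# * u (suc n) + (1# * u n + rest))
        ≈⟨ +-cong (zeroˡ _) (+-cong (zeroˡ _) (+-cong (*-identityˡ _) (sum-0* (λ (i : Fin n) → u (n ℕ.∸ suc (toℕ i)))))) ⟩
      0# + (0# + (u n + 0#))
        ≈⟨ trans (+-identityˡ _) (trans (+-identityˡ _) (+-identityʳ _)) ⟩
      u n ∎)
      where
      rest : Carrier
      rest = sum (λ (i : Fin n) → 0# * u (n ℕ.∸ suc (toℕ i)))

  -- Comparing coefficients of T² gives f₂ = g₀u₂ + g₁u₁ + u₀, where ℓ divides f₂, g₀ and g₁. Hence
  -- ℓ divides u₀, which has the inverse v₀. In a general ring this is not yet a contradiction.
  factorization⇒∣1 : ∀ ℓ f (w : WeierstrassFactorization ℓ f) →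
    let open WeierstrassFactorization w in μ ≡ 0 → deg ≡ 2 → ∀ {a} → f 2 ≈ a → ℓ ∣ a → ℓ ∣ 1#
  factorization⇒∣1 ℓ f record { g = g ; u = u ; distinguished = d ; unit = v , uv≈1 ; factorization = fac }
    ≡.refl ≡.refl f₂≈a (s , sℓ≈a)
    with d .IsDistinguished.nonLeading 0 (s≤s z≤n) | d .IsDistinguished.nonLeading 1 (s≤s (s≤s z≤n))
  ... | p , pℓ≈g₀ | q , qℓ≈g₁ = (s - (p * u 2 + q * u 1)) * v 0 , (begin
    (s - (p * u 2 + q * u 1)) * v 0 * ℓ   ≈⟨ eq s (p * u 2 + q * u 1) (v 0) ℓ ⟩
    (s * ℓ - (p * u 2 + q * u 1) * ℓ) * v 0 ≈⟨ *-congʳ u₀ ⟩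
    u 0 * v 0 ≈⟨ trans (sym (+-identityʳ _)) (uv≈1 0) ⟩
    1# ∎)
    where
    open import Algebra.Properties.Ring ring using (-‿distribˡ-*)
    eq : ∀ a b c d → (a - b) * c * d ≈ (a * d - b * d) * c
    eq a b c d = begin
      (a - b) * c * d ≈⟨ *-assoc (a - b) c d ⟩
      (a - b) * (c * d) ≈⟨ *-congˡ (*-comm c d) ⟩
      (a - b) * (d * c) ≈⟨ sym (*-assoc (a - b) d c) ⟩
      (a - b) * d * c ≈⟨ *-congʳ (trans (distribʳ d a (- b)) (+-congˡ (sym (-‿distribˡ-* b d)))) ⟩
      (a * d - b * d) * c ∎
    low : (p * u 2 + q * u 1) * ℓ ≈ g 0 * u 2 + g 1 * u 1
    low = trans (distribʳ ℓ (p * u 2) (q * u 1)) (+-cong (swap p (u 2) pℓ≈g₀) (swap q (u 1) qℓ≈g₁))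
      where
      swap : ∀ p a {b} → p * ℓ ≈ b → p * a * ℓ ≈ b * a
      swap p a e = trans (*-assoc p a ℓ) (trans (*-congˡ (*-comm a ℓ)) (trans (sym (*-assoc p ℓ a)) (*-congʳ e)))
    u₀ : s * ℓ - (p * u 2 + q * u 1) * ℓ ≈ u 0
    u₀ = begin
      s * ℓ - (p * u 2 + q * u 1) * ℓ
        ≈⟨ +-cong (trans sℓ≈a (trans (sym f₂≈a) (trans (fac 2) (*-identityˡ _)))) (-‿cong low) ⟩
      (g 0 * u 2 + (g 1 * u 1 + (g 2 * u 0 + 0#))) - (g 0 * u 2 + g 1 * u 1)
        ≈⟨ +-congʳ (sym (+-assoc _ _ _)) ⟩
      ((g 0 * u 2 + g 1 * u 1) + (g 2 * u 0 + 0#)) - (g 0 * u 2 + g 1 * u 1)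
        ≈⟨ +-congʳ (+-comm _ _) ⟩
      ((g 2 * u 0 + 0#) + (g 0 * u 2 + g 1 * u 1)) - (g 0 * u 2 + g 1 * u 1)
        ≈⟨ trans (+-assoc _ _ _) (trans (+-congˡ (-‿inverseʳ _)) (+-identityʳ _)) ⟩
      g 2 * u 0 + 0#
        ≈⟨ trans (+-identityʳ _) (trans (*-congʳ (d .IsDistinguished.monic)) (*-identityˡ _)) ⟩
      u 0 ∎

∑² : ∀ {t} → Vec ℤ t → ℤ
∑² []      = 0ℤ
∑² (a ∷ α) = a ℤ.* a ℤ.+ ∑² α

-- Inverses in the ℓ-adic integers and the low coefficients of the characteristic series

module PadicProperties (ℓ : ℕ) (ℓ-prime : Prime ℓ) where

  open Padic ℓ using (mod; divs; ℤℓ; approx; coherent; _≈_; mk≈; at; fromℤ; _+ℓ_; _*ℓ_; -ℓ_; ℤℓ-ring;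
    fallingℤ; binomialℤ; !*binomialℤ; characteristicSeries)
  open PowerSeries ℤℓ-ring
  open RawMagmaDefs (CommutativeRing.*-rawMagma ℤℓ-ring) using (_,_)
  open SeriesProperties ℤℓ-ring

  private instance
    ℓ≢0 : NonZero ℓ
    ℓ≢0 = prime⇒nonZero ℓ-prime

  pointwise : ∀ {a b : ℤℓ} → (∀ k → approx a k ≡ approx b k) → a ≈ b
  pointwise eq = mk≈ λ k → mod (divides 0ℤ (ℤ.i≡j⇒i-j≡0 (eq k)))

  bézout : ∀ s → ¬ (+ ℓ ℤ.∣ s) → ∃ λ b → ∃ λ q → s ℤ.* b ≡ 1ℤ ℤ.- q ℤ.* + ℓ
  bézout s ℓ∤s = signed s (coprime-Bézout coprime)
    where
    coprime : Coprime ∣ s ∣ ℓ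
    coprime (d∣s , d∣ℓ) with prime⇒irreducible ℓ-prime d∣ℓ
    ... | inj₁ d≡1    = d≡1
    ... | inj₂ ≡.refl = contradiction (ℤ.∣ᵤ⇒∣ d∣s) ℓ∤s

    cast : ∀ m n o → 1 ℕ.+ m ℕ.* n ≡ o → 1ℤ ℤ.+ + m ℤ.* + n ≡ + o
    cast m n o eq = ≡.trans (cong (ℤ._+_ 1ℤ) (≡.sym (ℤ.pos-* m n))) (cong +_ eq)

    natural : ∀ n → Bézout.Identity 1 n ℓ → ∃ λ b → ∃ λ q → + n ℤ.* b ≡ 1ℤ ℤ.- q ℤ.* + ℓ
    natural n (Bézout.+- x y eq) = + x , ℤ.- + y , ≡.trans (ℤ.*-comm (+ n) (+ x))
      (≡.trans (≡.sym (≡.trans (cast y ℓ _ eq) (ℤ.pos-* x n))) (rearrange (+ y) (+ ℓ)))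
      where
      rearrange : ∀ y l → 1ℤ ℤ.+ y ℤ.* l ≡ 1ℤ ℤ.- (ℤ.- y) ℤ.* l
      rearrange = ℤ-Solver.solve-∀
    natural n (Bézout.-+ x y eq) = ℤ.- + x , + y , ≡.trans (rearrange (+ n) (+ x))
      (cong (ℤ._-_ 1ℤ) (≡.trans (cast x n _ eq) (ℤ.pos-* y ℓ)))
      where
      rearrange : ∀ n x → n ℤ.* (ℤ.- x) ≡ 1ℤ ℤ.- (1ℤ ℤ.+ x ℤ.* n)
      rearrange = ℤ-Solver.solve-∀

    signed : ∀ s → Bézout.Identity 1 ∣ s ∣ ℓ → ∃ λ b → ∃ λ q → s ℤ.* b ≡ 1ℤ ℤ.- q ℤ.* + ℓ
    signed (+ n)    id = natural n id
    signed -[1+ n ] id = let b , q , eq = natural (suc n) id in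
      ℤ.- b , q , ≡.trans (rearrange (+ suc n) b) eq
      where
      rearrange : ∀ n b → (ℤ.- n) ℤ.* (ℤ.- b) ≡ n ℤ.* b
      rearrange = ℤ-Solver.solve-∀

  -- With s b = 1 - q ℓ, the inverse of s is b (1 + q ℓ + (q ℓ)² + ⋯).
  ∤⇒invertible : ∀ s → ¬ (+ ℓ ℤ.∣ s) → ∃ λ w → fromℤ s *ℓ w ≈ fromℤ 1ℤ
  ∤⇒invertible s ℓ∤s = inverse , mk≈ λ k → mod (subst (+ (ℓ ℕ.^ k) ℤ.∣_)
      (≡.trans (cong (λ z → z ℤ.* geometric k ℤ.- 1ℤ) (≡.sym sb)) (cong (ℤ._- 1ℤ) (ℤ.*-assoc s b (geometric k))))
      (remainder k))
    where
    b q : ℤ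
    b = proj₁ (bézout s ℓ∤s)
    q = proj₁ (proj₂ (bézout s ℓ∤s)) ℤ.* + ℓ
    sb : s ℤ.* b ≡ 1ℤ ℤ.- q
    sb = proj₂ (proj₂ (bézout s ℓ∤s))

    geometric : ℕ → ℤ
    geometric zero    = 0ℤ
    geometric (suc k) = 1ℤ ℤ.+ q ℤ.* geometric k

    ℓ^∣q* : ∀ k {a} → + (ℓ ℕ.^ k) ℤ.∣ a → + (ℓ ℕ.^ suc k) ℤ.∣ q ℤ.* a
    ℓ^∣q* k {a} (divides c a≡) = divides (p ℤ.* c) (≡.trans (cong (q ℤ.*_) a≡)
      (≡.trans (rearrange p (+ ℓ) c (+ (ℓ ℕ.^ k))) (cong (p ℤ.* c ℤ.*_) (≡.sym (ℤ.pos-* ℓ (ℓ ℕ.^ k))))))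
      where
      p : ℤ
      p = proj₁ (proj₂ (bézout s ℓ∤s))
      rearrange : ∀ p l c m → p ℤ.* l ℤ.* (c ℤ.* m) ≡ p ℤ.* c ℤ.* (l ℤ.* m)
      rearrange = ℤ-Solver.solve-∀

    1∣ : ∀ a → 1ℤ ℤ.∣ a
    1∣ a = divides a (≡.sym (ℤ.*-identityʳ a))

    -- The number is -qᵏ, and the one in `difference` is qᵏ; here `q` already contains the factor ℓ.
    remainder : ∀ k → + (ℓ ℕ.^ k) ℤ.∣ (1ℤ ℤ.- q) ℤ.* geometric k ℤ.- 1ℤ
    remainder zero    = 1∣ _
    remainder (suc k) = subst (+ (ℓ ℕ.^ suc k) ℤ.∣_) (rearrange q (geometric k)) (ℓ^∣q* k (remainder k))
      where
      rearrange : ∀ q g → q ℤ.* ((1ℤ ℤ.- q) ℤ.* g ℤ.- 1ℤ) ≡ (1ℤ ℤ.- q) ℤ.* (1ℤ ℤ.+ q ℤ.* g) ℤ.- 1ℤ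
      rearrange = ℤ-Solver.solve-∀

    difference : ∀ k → + (ℓ ℕ.^ k) ℤ.∣ geometric (suc k) ℤ.- geometric k
    difference zero    = 1∣ _
    difference (suc k) = subst (+ (ℓ ℕ.^ suc k) ℤ.∣_)
      (rearrange q (geometric (suc k)) (geometric k)) (ℓ^∣q* k (difference k))
      where
      rearrange : ∀ q g h → q ℤ.* (g ℤ.- h) ≡ (1ℤ ℤ.+ q ℤ.* g) ℤ.- (1ℤ ℤ.+ q ℤ.* h)
      rearrange = ℤ-Solver.solve-∀

    inverse : ℤℓ
    inverse = record
      { approx   = λ k → b ℤ.* geometric k
      ; coherent = λ k → mod (subst (+ (ℓ ℕ.^ k) ℤ.∣_) (rearrange b (geometric (suc k)) (geometric k))
          (ℤ.∣n⇒∣m*n b (difference k)))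
      }
      where
      rearrange : ∀ b g h → b ℤ.* (g ℤ.- h) ≡ b ℤ.* g ℤ.- b ℤ.* h
      rearrange = ℤ-Solver.solve-∀

  -- The residue modulo ℓ¹ already excludes it, since 1 would be a multiple of a prime.
  ℓ∤1 : ¬ (fromℤ (+ ℓ) ∣ fromℤ 1ℤ)
  ℓ∤1 (q , qℓ≈1) = ℕ.>⇒∤ (ℕ.nonTrivial⇒n>1 ℓ {{prime⇒nonTrivial ℓ-prime}}) (ℤ.∣⇒∣ᵤ ℓ∣1)
    where
    ℓ∣1 : + ℓ ℤ.∣ 1ℤ
    ℓ∣1 = subst (+ ℓ ℤ.∣_) (rearrange (approx q 1 ℤ.* + ℓ))
      (ℤ.∣m∣n⇒∣m-n (divides (approx q 1) ≡.refl)
        (subst (λ n → + n ℤ.∣ approx q 1 ℤ.* + ℓ ℤ.- 1ℤ) (ℕ.*-identityʳ ℓ) (divs (at qℓ≈1 1))))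
      where
      rearrange : ∀ a → a ℤ.- (a ℤ.- 1ℤ) ≡ 1ℤ
      rearrange = ℤ-Solver.solve-∀

  -- Keeping m and c abstract prevents the conversion checker from unfolding the
  -- integer division in binomialℤ.
  !*binomialℤ′ : ∀ b n {m c} → n ! ≡ m → fallingℤ b n ≡ c → + m ℤ.* binomialℤ b n ≡ c
  !*binomialℤ′ b n ≡.refl ≡.refl = !*binomialℤ b n

  binomialℤ-1 : ∀ a → binomialℤ a 1 ≡ a
  binomialℤ-1 a = ≡.trans (≡.sym (ℤ.*-identityˡ _)) (≡.trans (!*binomialℤ′ a 1 {1} ≡.refl ≡.refl) (rearrange a))
    where
    rearrange : ∀ a → 1ℤ ℤ.* (a ℤ.- 0ℤ) ≡ a
    rearrange = ℤ-Solver.solve-∀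

  -- Doubling turns the two binomials into a(a - 1) and a(a + 1), with sum 2a²; cancelling 2
  -- afterwards avoids computing with the integer division.
  binomialℤ-2 : ∀ a → 0ℤ ℤ.- binomialℤ a 2 ℤ.- binomialℤ (ℤ.- a) 2 ≡ ℤ.- (a ℤ.* a)
  binomialℤ-2 a = halve a (binomialℤ a 2) (binomialℤ (ℤ.- a) 2)
    (!*binomialℤ′ a 2 {2} ≡.refl ≡.refl) (!*binomialℤ′ (ℤ.- a) 2 {2} ≡.refl ≡.refl)
    where
    halve : ∀ a x y → + 2 ℤ.* x ≡ 1ℤ ℤ.* (a ℤ.- 0ℤ) ℤ.* (a ℤ.- 1ℤ) →
            + 2 ℤ.* y ≡ 1ℤ ℤ.* (ℤ.- a ℤ.- 0ℤ) ℤ.* (ℤ.- a ℤ.- 1ℤ) → 0ℤ ℤ.- x ℤ.- y ≡ ℤ.- (a ℤ.* a)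
    halve a x y 2x≡ 2y≡ = ℤ.*-cancelˡ-≡ (+ 2) _ _ (≡.trans (rearrange₁ x y)
      (≡.trans (cong₂ (λ x y → 0ℤ ℤ.- x ℤ.- y) 2x≡ 2y≡) (rearrange₂ a)))
      where
      rearrange₁ : ∀ x y → + 2 ℤ.* (0ℤ ℤ.- x ℤ.- y) ≡ 0ℤ ℤ.- + 2 ℤ.* x ℤ.- + 2 ℤ.* y
      rearrange₁ = ℤ-Solver.solve-∀
      rearrange₂ : ∀ a → 0ℤ ℤ.- 1ℤ ℤ.* (a ℤ.- 0ℤ) ℤ.* (a ℤ.- 1ℤ) ℤ.- 1ℤ ℤ.* (ℤ.- a ℤ.- 0ℤ) ℤ.* (ℤ.- a ℤ.- 1ℤ)
                       ≡ + 2 ℤ.* ℤ.- (a ℤ.* a)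
      rearrange₂ = ℤ-Solver.solve-∀

  -- The names are qualified so that characteristicSeries β unfolds to a sum of,
  -- literally, these; otherwise the conversion checker compares coherence proofs.
  summand : ℤℓ → Padic.Series ℓ ℓ-prime
  summand b = Padic._-ₛ_ ℓ ℓ-prime
    (Padic._-ₛ_ ℓ ℓ-prime (Padic.constant ℓ ℓ-prime (Padic.fromℤ ℓ (+ 2))) (Padic.[1+T]^_ ℓ ℓ-prime b))
    (Padic.[1+T]^_ ℓ ℓ-prime (Padic.-ℓ_ ℓ b))

  -- For the same reason the embedding of α in ℤℓ is a variable with an equation.
  module _ {t} (α : Vec ℤ t) (β : Vector ℤℓ t) (β≡α : ∀ j → β j ≡ fromℤ (lookup α j)) where

    -- For an integer voltage the approximations of a coefficient are the same integer at every
    -- precision `k`, so the computation takes place in ℤ: `c` is the contribution of one loop and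
    -- `s` that of all loops.
    coefficient : ∀ n (c : ℤ → ℤ) (s : ∀ {t} → Vec ℤ t → ℤ) → s [] ≡ 0ℤ →
      (∀ {t} a (α : Vec ℤ t) → c a ℤ.+ s α ≡ s (a ∷ α)) →
      (∀ a k → approx (summand (fromℤ a) n) k ≡ c a) →
      characteristicSeries ℓ-prime β n ≈ fromℤ (s α)
    coefficient n c s s[] s∷ eq = sum-additive fromℤ c s
      (pointwise {fromℤ (s [])} {fromℤ 0ℤ} λ k → s[])
      (λ a α → pointwise {fromℤ (c a) +ℓ fromℤ (s α)} {fromℤ (s (a ∷ α))} λ k → s∷ a α)
      α (λ j → summand (β j) n)
      (λ j → pointwise {summand (β j) n} {fromℤ (c (lookup α j))}
        λ k → ≡.trans (cong (λ b → approx (summand b n) k) (β≡α j)) (eq (lookup α j) k))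

    coefficient₀ : characteristicSeries ℓ-prime β 0 ≈ fromℤ 0ℤ
    coefficient₀ = coefficient 0 (λ _ → 0ℤ) (λ _ → 0ℤ) ≡.refl (λ _ _ → ≡.refl) λ a k → ≡.refl

    coefficient₁ : characteristicSeries ℓ-prime β 1 ≈ fromℤ 0ℤ
    coefficient₁ = coefficient 1 (λ _ → 0ℤ) (λ _ → 0ℤ) ≡.refl (λ _ _ → ≡.refl) λ a k →
      ≡.trans (cong₂ (λ x y → 0ℤ ℤ.- x ℤ.- y) (binomialℤ-1 a) (binomialℤ-1 (ℤ.- a))) (rearrange a)
      where
      rearrange : ∀ a → 0ℤ ℤ.- a ℤ.- (ℤ.- a) ≡ 0ℤ
      rearrange = ℤ-Solver.solve-∀

    coefficient₂ : characteristicSeries ℓ-prime β 2 ≈ fromℤ (ℤ.- ∑² α)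
    coefficient₂ = coefficient 2 (λ a → ℤ.- (a ℤ.* a)) (λ α → ℤ.- ∑² α) ≡.refl
      (λ a α → ≡.sym (ℤ.neg-distrib-+ (a ℤ.* a) (∑² α))) λ a k → binomialℤ-2 a

  fromℤ-∣ : ∀ a → + ℓ ℤ.∣ a → fromℤ (+ ℓ) ∣ fromℤ a
  fromℤ-∣ a (divides q a≡qℓ) = fromℤ q ,
    pointwise {fromℤ q *ℓ fromℤ (+ ℓ)} {fromℤ a} λ k → ≡.sym a≡qℓ

  module _ {t} (α : Vec ℤ t) (β : Vector ℤℓ t) (β≡α : ∀ j → β j ≡ fromℤ (lookup α j)) where

    invariants⇒∤ : Padic.HasIwasawaInvariants ℓ ℓ-prime β 0 1ℤ → ¬ (+ ℓ ℤ.∣ ∑² α)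
    invariants⇒∤ (w , μ≡0 , deg-1≡1) ℓ∣∑² = ℓ∤1 (factorization⇒∣1 (fromℤ (+ ℓ))
        (characteristicSeries ℓ-prime β) w μ≡0
        -- λ is the degree minus one, so λ = 1 means degree 2.
        (ℤ.+-injective (≡.trans (shift (+ _)) (cong (ℤ._+ 1ℤ) deg-1≡1)))
        {fromℤ (ℤ.- ∑² α)} (coefficient₂ α β β≡α) (fromℤ-∣ (ℤ.- ∑² α) (ℤ.∣m⇒∣-m ℓ∣∑²)))
      where
      shift : ∀ d → d ≡ d ℤ.- 1ℤ ℤ.+ 1ℤ
      shift = ℤ-Solver.solve-∀

    ∤⇒invariants : ¬ (+ ℓ ℤ.∣ ∑² α) → Padic.HasIwasawaInvariants ℓ ℓ-prime β 0 1ℤ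
    ∤⇒invariants ℓ∤∑² = T²-factorization (fromℤ (+ ℓ)) (characteristicSeries ℓ-prime β)
        (coefficient₀ α β β≡α) (coefficient₁ α β β≡α)
        {fromℤ (ℤ.- ∑² α)} (coefficient₂ α β β≡α) (proj₁ inverse) (proj₂ inverse)
        , ≡.refl , ≡.refl
      where
      inverse : ∃ λ w → fromℤ (ℤ.- ∑² α) *ℓ w ≈ fromℤ 1ℤ
      inverse = ∤⇒invertible (ℤ.- ∑² α) λ ℓ∣-∑² → ℓ∤∑² (subst (+ ℓ ℤ.∣_) (ℤ.neg-involutive (∑² α)) (ℤ.∣m⇒∣-m ℓ∣-∑²))

open import Data.Nat.Base hiding (_/_; _%_; ∣_-_∣)
open import Data.Nat.Properties
open import Relation.Binary.PropositionalEquality using (refl; sym; trans; module ≡-Reasoning)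

private variable
  A B C : Set

-- Counting lattice points by their sum of squares modulo ℓ

total : (A → ℕ) → List A → ℕ
total f xs = ℕ.sum (map f xs)

total-cong : {f g : A → ℕ} → (∀ x → f x ≡ g x) → ∀ xs → total f xs ≡ total g xs
total-cong f≡g []       = refl
total-cong f≡g (x ∷ xs) = cong₂ _+_ (f≡g x) (total-cong f≡g xs)

total-mono : {f g : A → ℕ} → (∀ x → f x ≤ g x) → ∀ xs → total f xs ≤ total g xs
total-mono f≤g []       = z≤n
total-mono f≤g (x ∷ xs) = +-mono-≤ (f≤g x) (total-mono f≤g xs)

total-+ : (f g : A → ℕ) → ∀ xs → total (λ x → f x + g x) xs ≡ total f xs + total g xs
total-+ f g []       = refl
total-+ f g (x ∷ xs) = trans (cong (_+_ (f x + g x)) (total-+ f g xs)) (eq (f x) (g x) (total f xs) (total g xs))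
  where
  eq : ∀ a b c d → a + b + (c + d) ≡ a + c + (b + d)
  eq = solve-∀

total-*ˡ : ∀ n (f : A → ℕ) xs → total (λ x → n * f x) xs ≡ n * total f xs
total-*ˡ n f []       = sym (*-zeroʳ n)
total-*ˡ n f (x ∷ xs) = trans (cong (_+_ (n * f x)) (total-*ˡ n f xs)) (sym (*-distribˡ-+ n (f x) (total f xs)))

total-const : ∀ n (xs : List A) → total (λ _ → n) xs ≡ length xs * n
total-const n []       = refl
total-const n (x ∷ xs) = cong (_+_ n) (total-const n xs)

total-++ : (f : A → ℕ) → ∀ xs ys → total f (xs ++ ys) ≡ total f xs + total f ys
total-++ f []       ys = refl
total-++ f (x ∷ xs) ys = trans (cong (_+_ (f x)) (total-++ f xs ys)) (sym (+-assoc (f x) (total f xs) (total f ys)))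

total-map : (f : B → ℕ) (g : A → B) → ∀ xs → total f (map g xs) ≡ total (f ∘ g) xs
total-map f g []       = refl
total-map f g (x ∷ xs) = cong (_+_ (f (g x))) (total-map f g xs)

total-cartesianProductWith : (f : C → ℕ) (g : A → B → C) → ∀ xs ys →
  total f (cartesianProductWith g xs ys) ≡ total (λ x → total (f ∘ g x) ys) xs
total-cartesianProductWith f g []       ys = refl
total-cartesianProductWith f g (x ∷ xs) ys =
  trans (total-++ f (map (g x) ys) _)
    (cong₂ _+_ (total-map f (g x) ys) (total-cartesianProductWith f g xs ys))

total-swap : (f : A → B → ℕ) → ∀ xs ys →
  total (λ x → total (f x) ys) xs ≡ total (λ y → total (λ x → f x y) xs) ys
total-swap f []       ys = sym (trans (total-const 0 ys) (*-zeroʳ (length ys)))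
total-swap f (x ∷ xs) ys = trans (cong (_+_ (total (f x) ys)) (total-swap f xs ys))
  (sym (total-+ (f x) (λ y → total (λ x → f x y) xs) ys))

𝟙 : Dec C → ℕ
𝟙 (yes _) = 1
𝟙 (no _)  = 0

𝟙-cong : (A? : Dec A) (B? : Dec B) → (A → B) → (B → A) → 𝟙 A? ≡ 𝟙 B?
𝟙-cong (yes a) (yes b) f g = refl
𝟙-cong (yes a) (no ¬b) f g = contradiction (f a) ¬b
𝟙-cong (no ¬a) (yes b) f g = contradiction (g b) ¬a
𝟙-cong (no ¬a) (no ¬b) f g = refl

length-filter≡total : {P : A → Set} (P? : ∀ x → Dec (P x)) → ∀ xs →
  length (filter P? xs) ≡ total (𝟙 ∘ P?) xs
length-filter≡total P? []       = refl
length-filter≡total P? (x ∷ xs) with P? x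
... | yes _ = cong suc (length-filter≡total P? xs)
... | no  _ = length-filter≡total P? xs

∃≤average : ∀ f n h → total f (downFrom (suc n)) ≤ suc n * h → ∃ λ i → i ≤ n × f i ≤ h
∃≤average f zero h le = 0 , z≤n , subst₂ _≤_ (+-identityʳ (f 0)) (+-identityʳ h) le
∃≤average f (suc n) h le with f (suc n) ≤? h
... | yes f≤h = suc n , ≤-refl , f≤h
... | no  f≰h =
  let i , i≤n , fi≤h = ∃≤average f n h (+-cancelˡ-≤ h _ _
        (≤-trans (+-monoˡ-≤ _ (<⇒≤ (≰⇒> f≰h))) le))
  in  i , m≤n⇒m≤1+n i≤n , fi≤h

unique-length : {xs ys : List A} → Unique xs → Unique ys →
  (∀ a → a ∈ xs ⇔ a ∈ ys) → length xs ≡ length ys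
unique-length p q eq = ↭-length (∼bag⇒↭ (unique∧set⇒bag p q (eq _)))

total-downFrom-+ : ∀ (f : ℕ → ℕ) m n →
  total f (downFrom (m + n)) ≡ total (λ i → f (i + n)) (downFrom m) + total f (downFrom n)
total-downFrom-+ f zero    n = refl
total-downFrom-+ f (suc m) n = trans (cong (_+_ (f (m + n))) (total-downFrom-+ f m n))
  (sym (+-assoc (f (m + n)) _ _))

-- Two ranges matter: a period, of length ℓ, and [-N, N], of length 2N + 1. Sums over consecutive
-- integers cover both.
window : (ℤ → ℕ) → ℤ → ℕ → ℕ
window f s n = total (λ i → f (s ℤ.+ + i)) (downFrom n)

window-+ : ∀ f s m n → window f s (m + n) ≡ window f (s ℤ.+ + n) m + window f s n
window-+ f s m n = trans (total-downFrom-+ _ m n)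
  (cong (_+ window f s n) (total-cong (λ i → cong f (eq s i)) (downFrom m)))
  where
  eq : ∀ s i → s ℤ.+ + (i + n) ≡ s ℤ.+ + n ℤ.+ + i
  eq s i = trans (cong (ℤ._+_ s) (trans (cong +_ (+-comm i n)) (ℤ.pos-+ n i))) (sym (ℤ.+-assoc s (+ n) (+ i)))

window-mono : ∀ f s {m n} → m ≤ n → window f s m ≤ window f s n
window-mono f s {m} {n} m≤n = subst (λ k → window f s m ≤ window f s k) (m∸n+n≡m m≤n)
  (subst (window f s m ≤_) (sym (window-+ f s (n ∸ m) m)) (m≤n+m _ _))

module _ (ℓ : ℕ) .{{_ : NonZero ℓ}} where

  infix 4 ℓ∣?_
  ℓ∣?_ : ∀ a → Dec (+ ℓ ℤ.∣ a)
  ℓ∣? a = + ℓ ℤ.∣? a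

  private
    mult : ℤ → ℕ
    mult a = 𝟙 (ℓ∣? a)

  window-multiples : ∀ s → window mult s ℓ ≡ 1
  window-multiples s = trans
    (sym (length-filter≡total (λ i → ℓ∣? s ℤ.+ + i) (downFrom ℓ)))
    (unique-length {ys = i₀ ∷ []} (Unique.filter⁺ _ (Unique.downFrom⁺ ℓ)) ([] ∷ [])
      λ i → mk⇔ to from)
    where
    i₀ : ℕ
    i₀ = (ℤ.- s) ℤ.%ℕ ℓ
    i₀≡-s : + ℓ ℤ.∣ s ℤ.+ + i₀
    i₀≡-s = divides (ℤ.- ((ℤ.- s) ℤ./ℕ ℓ)) (trans
      (eq s (+ i₀) ((ℤ.- s) ℤ./ℕ ℓ ℤ.* + ℓ) (ℤ.a≡a%ℕn+[a/ℕn]*n (ℤ.- s) ℓ))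
      (ℤ.neg-distribˡ-* ((ℤ.- s) ℤ./ℕ ℓ) (+ ℓ)))
      where
      eq : ∀ s i q → ℤ.- s ≡ i ℤ.+ q → s ℤ.+ i ≡ ℤ.- q
      eq s i q e = trans (e₁ s i) (trans (cong (λ z → ℤ.- z ℤ.+ i) e) (e₂ i q))
        where
        e₁ : ∀ s i → s ℤ.+ i ≡ ℤ.- (ℤ.- s) ℤ.+ i
        e₁ = ℤ-Solver.solve-∀
        e₂ : ∀ i q → ℤ.- (i ℤ.+ q) ℤ.+ i ≡ ℤ.- q
        e₂ = ℤ-Solver.solve-∀
    i₀<ℓ : i₀ < ℓ
    i₀<ℓ = ℤ.n%ℕd<d (ℤ.- s) ℓ
    only-zero : ∀ d → d < ℓ → + ℓ ℤ.∣ + d → d ≡ 0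
    only-zero zero    _   _  = refl
    only-zero (suc d) d<ℓ dv = contradiction (ℤ.∣⇒∣ᵤ dv) (ℕ.>⇒∤ d<ℓ)
    close : ∀ i j → i ≤ j → j < ℓ → + ℓ ℤ.∣ s ℤ.+ + i → + ℓ ℤ.∣ s ℤ.+ + j → i ≡ j
    close i j i≤j j<ℓ di dj = ≤-antisym i≤j (m∸n≡0⇒m≤n
      (only-zero (j ∸ i) (≤-<-trans (m∸n≤m j i) j<ℓ)
        (subst (+ ℓ ℤ.∣_) (trans (eq s (+ j) (+ i)) (trans (ℤ.m-n≡m⊖n j i) (ℤ.⊖-≥ i≤j)))
          (ℤ.∣m∣n⇒∣m-n dj di))))
      where
      eq : ∀ s i j → s ℤ.+ i ℤ.- (s ℤ.+ j) ≡ i ℤ.- j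
      eq = ℤ-Solver.solve-∀
    to : ∀ {i} → i ∈ filter (λ i → ℓ∣? s ℤ.+ + i) (downFrom ℓ) → i ∈ i₀ ∷ []
    to {i} i∈ with ∈-filter⁻ (λ i → ℓ∣? s ℤ.+ + i) {xs = downFrom ℓ} i∈
    ... | i∈d , dv with ≤-total i i₀
    ...   | inj₁ i≤i₀ = here (close i i₀ i≤i₀ i₀<ℓ dv i₀≡-s)
    ...   | inj₂ i₀≤i = here (sym (close i₀ i i₀≤i (∈-downFrom⁻ i∈d) i₀≡-s dv))
    from : ∀ {i} → i ∈ i₀ ∷ [] → i ∈ filter (λ i → ℓ∣? s ℤ.+ + i) (downFrom ℓ)
    from (here refl) = ∈-filter⁺ _ (∈-downFrom⁺ i₀<ℓ) i₀≡-s

  window-multiples-* : ∀ s q → window mult s (q * ℓ) ≡ q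
  window-multiples-* s zero    = refl
  window-multiples-* s (suc q) = trans (window-+ mult s ℓ (q * ℓ))
    (cong₂ _+_ (window-multiples (s ℤ.+ + (q * ℓ))) (window-multiples-* s q))

  window-multiples-≥ : ∀ s n → n ℕ./ ℓ ≤ window mult s n
  window-multiples-≥ s n = subst (_≤ window mult s n) (window-multiples-* s (n ℕ./ ℓ))
    (window-mono mult s (ℕ.m/n*n≤m n ℓ))

  window-multiples-≤ : ∀ s n → window mult s n ≤ suc (n ℕ./ ℓ)
  window-multiples-≤ s n = subst (window mult s n ≤_) (window-multiples-* s (suc (n ℕ./ ℓ)))
    (window-mono mult s (subst (_≤ ℓ + n ℕ./ ℓ * ℓ) (sym (ℕ.m≡m%n+[m/n]*n n ℓ))
      (+-monoˡ-≤ _ (<⇒≤ (ℕ.m%n<n n ℓ)))))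

  -- Functions on ℤ/ℓ are represented by their lifts to ℤ, so that r - a² needs no reduction.
  record Periodic (f : ℤ → ℕ) : Set where
    constructor periodic
    field respects : ∀ r s → + ℓ ℤ.∣ r ℤ.- s → f r ≡ f s

  open Periodic public

  mult-periodic : Periodic mult
  mult-periodic = periodic λ r s d → 𝟙-cong (ℓ∣? r) (ℓ∣? s)
    (λ ℓ∣r → subst (+ ℓ ℤ.∣_) (eq₁ r s) (ℤ.∣m∣n⇒∣m-n ℓ∣r d))
    (λ ℓ∣s → subst (+ ℓ ℤ.∣_) (eq₂ r s) (ℤ.∣m∣n⇒∣m+n ℓ∣s d))
    where
    eq₁ : ∀ r s → r ℤ.- (r ℤ.- s) ≡ s
    eq₁ = ℤ-Solver.solve-∀
    eq₂ : ∀ r s → s ℤ.+ (r ℤ.- s) ≡ r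
    eq₂ = ℤ-Solver.solve-∀

  module _ (N : ℕ) where

    W : ℕ
    W = suc (N + N)

    interval : List ℤ
    interval = map (λ i → ℤ.- + N ℤ.+ + i) (downFrom W)

    length-interval : length interval ≡ W
    length-interval = trans (length-map _ (downFrom W)) (length-downFrom W)

    -- Transfer operator of the walk: if `f` counts vectors by the residue of their sum of squares,
    -- `step f` does so after a coordinate from [-N, N] is prepended.
    step : (ℤ → ℕ) → ℤ → ℕ
    step f r = total (λ a → f (r ℤ.- a ℤ.* a)) interval

    #residue : ℤ → ℕ
    #residue i = total (λ a → mult (a ℤ.- i)) interval

    #residue≡window : ∀ i → #residue i ≡ window mult (ℤ.- + N ℤ.- i) W
    #residue≡window i = trans (total-map _ _ (downFrom W))
      (total-cong (λ j → cong mult (eq (ℤ.- + N) i (+ j))) (downFrom W))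
      where
      eq : ∀ n i j → n ℤ.+ j ℤ.- i ≡ n ℤ.- i ℤ.+ j
      eq = ℤ-Solver.solve-∀

    #residue-≥ : ∀ i → W ℕ./ ℓ ≤ #residue i
    #residue-≥ i = subst (W ℕ./ ℓ ≤_) (sym (#residue≡window i)) (window-multiples-≥ (ℤ.- + N ℤ.- i) W)

    #residue-≤ : ∀ i → #residue i ≤ suc (W ℕ./ ℓ)
    #residue-≤ i = subst (_≤ suc (W ℕ./ ℓ)) (sym (#residue≡window i)) (window-multiples-≤ (ℤ.- + N ℤ.- i) W)

    step-periodic : ∀ {f} → Periodic f → Periodic (step f)
    step-periodic {f} per = periodic λ r s d → total-cong
      (λ a → respects per _ _ (subst (+ ℓ ℤ.∣_) (eq r s (a ℤ.* a)) d)) interval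
      where
      eq : ∀ r s a → r ℤ.- s ≡ (r ℤ.- a) ℤ.- (s ℤ.- a)
      eq = ℤ-Solver.solve-∀

    step-≤ : ∀ {f h} → (∀ r → f r ≤ h) → ∀ r → step f r ≤ W * h
    step-≤ {f} {h} f≤h r = ≤-trans (total-mono (λ a → f≤h (r ℤ.- a ℤ.* a)) interval)
      (≤-reflexive (trans (total-const h interval) (cong (_* h) length-interval)))

    -- The condition i² = i selects 0 and 1. If a ≡ i modulo ℓ, then a² ≡ i and r + i - a² ≡ r, so
    -- this summand inherits the gap at `r`; at least ⌊W/ℓ⌋ of the a are of this kind.
    step-gap : ∀ {f h} → Periodic f → (∀ r → f r ≤ h) → ∀ i → i ℤ.* i ≡ i →
               ∀ r g → f r + g ≤ h → step f (r ℤ.+ i) + W ℕ./ ℓ * g ≤ W * h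
    step-gap {f} {h} per f≤h i i²≡i r g gap = begin
      step f (r ℤ.+ i) + W ℕ./ ℓ * g
        ≤⟨ +-monoʳ-≤ (step f (r ℤ.+ i)) (*-monoˡ-≤ g (#residue-≥ i)) ⟩
      step f (r ℤ.+ i) + #residue i * g
        ≡⟨ cong (_+_ (step f (r ℤ.+ i))) (trans (*-comm (#residue i) g) (sym (total-*ˡ g _ interval))) ⟩
      step f (r ℤ.+ i) + total (λ a → g * mult (a ℤ.- i)) interval
        ≡⟨ sym (total-+ (λ a → f (r ℤ.+ i ℤ.- a ℤ.* a)) (λ a → g * mult (a ℤ.- i)) interval) ⟩
      total (λ a → f (r ℤ.+ i ℤ.- a ℤ.* a) + g * mult (a ℤ.- i)) interval
        ≤⟨ total-mono termwise interval ⟩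
      total (λ _ → h) interval
        ≡⟨ trans (total-const h interval) (cong (_* h) length-interval) ⟩
      W * h ∎
      where
      open ≤-Reasoning
      eq : ∀ r i a → (r ℤ.+ i ℤ.- a ℤ.* a) ℤ.- r ≡ i ℤ.- i ℤ.* i ℤ.+ ℤ.- (a ℤ.+ i) ℤ.* (a ℤ.- i)
      eq = ℤ-Solver.solve-∀
      eq′ : ∀ a → (r ℤ.+ i ℤ.- a ℤ.* a) ℤ.- r ≡ ℤ.- (a ℤ.+ i) ℤ.* (a ℤ.- i)
      eq′ a = trans (eq r i a) (trans (cong (λ z → i ℤ.- z ℤ.+ ℤ.- (a ℤ.+ i) ℤ.* (a ℤ.- i)) i²≡i)
        (trans (cong (ℤ._+ ℤ.- (a ℤ.+ i) ℤ.* (a ℤ.- i)) (ℤ.+-inverseʳ i)) (ℤ.+-identityˡ _)))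
      termwise : ∀ a → f (r ℤ.+ i ℤ.- a ℤ.* a) + g * mult (a ℤ.- i) ≤ h
      termwise a with ℓ∣? a ℤ.- i
      ... | yes d = subst₂ (λ x y → x + y ≤ h)
              (sym (respects per _ _ (subst (+ ℓ ℤ.∣_) (sym (eq′ a)) (ℤ.∣n⇒∣m*n (ℤ.- (a ℤ.+ i)) d))))
              (sym (*-identityʳ g)) gap
      ... | no  _ = subst (λ x → f (r ℤ.+ i ℤ.- a ℤ.* a) + x ≤ h) (sym (*-zeroʳ g))
              (subst (_≤ h) (sym (+-identityʳ _)) (f≤h _))

    iterate : ℕ → (ℤ → ℕ) → ℤ → ℕ
    iterate zero    f = f
    iterate (suc j) f = step (iterate j f)

    iterate-periodic : ∀ j {f} → Periodic f → Periodic (iterate j f)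
    iterate-periodic zero    per = per
    iterate-periodic (suc j) per = step-periodic (iterate-periodic j per)

    iterate-≤ : ∀ j {f h} → (∀ r → f r ≤ h) → ∀ r → iterate j f r ≤ W ^ j * h
    iterate-≤ zero    {h = h} f≤h r = ≤-trans (f≤h r) (≤-reflexive (sym (*-identityˡ h)))
    iterate-≤ (suc j) {h = h} f≤h r = ≤-trans (step-≤ (iterate-≤ j f≤h) r)
      (≤-reflexive (sym (*-assoc W (W ^ j) h)))

    iterate-*ˡ : ∀ j n f r → iterate j (λ s → n * f s) r ≡ n * iterate j f r
    iterate-*ˡ zero    n f r = refl
    iterate-*ˡ (suc j) n f r = trans (total-cong (λ a → iterate-*ˡ j n f _) interval)
      (total-*ˡ n _ interval)

    iterate-+ : ∀ j k f r → iterate j (iterate k f) r ≡ iterate (j + k) f r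
    iterate-+ zero    k f r = refl
    iterate-+ (suc j) k f r = total-cong (λ a → iterate-+ j k f _) interval

    -- Each step keeps the gap in place or moves it by one, with weight ⌊W/ℓ⌋, so j steps carry it
    -- to each of r, ..., r + j.
    iterate-gap : ∀ {f h} → Periodic f → (∀ r → f r ≤ h) → ∀ r g → f r + g ≤ h →
      ∀ j i → i ≤ j → iterate j f (r ℤ.+ + i) + (W ℕ./ ℓ) ^ j * g ≤ W ^ j * h
    iterate-gap {f} {h} per f≤h r g gap zero zero z≤n =
      subst₂ _≤_ (cong₂ _+_ (cong f (sym (ℤ.+-identityʳ r))) (sym (*-identityˡ g))) (sym (*-identityˡ h)) gap
    iterate-gap {f} {h} per f≤h r g gap (suc j) i i≤1+j =
      subst₂ _≤_ (cong (_+_ (iterate (suc j) f (r ℤ.+ + i))) (sym (*-assoc (W ℕ./ ℓ) ((W ℕ./ ℓ) ^ j) g)))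
        (sym (*-assoc W (W ^ j) h))
        (advance i i≤1+j)
      where
      one : ∀ i → i ℤ.* i ≡ i → ∀ k → k ≤ j →
        iterate (suc j) f (r ℤ.+ + k ℤ.+ i) + W ℕ./ ℓ * ((W ℕ./ ℓ) ^ j * g) ≤ W * (W ^ j * h)
      one i i²≡i k k≤j = step-gap (iterate-periodic j per) (iterate-≤ j f≤h) i i²≡i (r ℤ.+ + k)
        ((W ℕ./ ℓ) ^ j * g) (iterate-gap per f≤h r g gap j k k≤j)
      advance : ∀ i → i ≤ suc j →
        iterate (suc j) f (r ℤ.+ + i) + W ℕ./ ℓ * ((W ℕ./ ℓ) ^ j * g) ≤ W * (W ^ j * h)
      -- Position 0 is reached by staying there, position 1 + i by moving on from i.
      advance zero    _       = subst (λ z → iterate (suc j) f z + W ℕ./ ℓ * ((W ℕ./ ℓ) ^ j * g) ≤ W * (W ^ j * h))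
        (ℤ.+-identityʳ (r ℤ.+ 0ℤ)) (one 0ℤ refl 0 z≤n)
      advance (suc i) (s≤s i≤j) = subst (λ z → iterate (suc j) f z + W ℕ./ ℓ * ((W ℕ./ ℓ) ^ j * g) ≤ W * (W ^ j * h))
        (eq r (+ i)) (one 1ℤ refl i i≤j)
        where
        eq : ∀ r i → r ℤ.+ i ℤ.+ 1ℤ ≡ r ℤ.+ (1ℤ ℤ.+ i)
        eq = ℤ-Solver.solve-∀

    -- Conservation of mass: a period translated by a² is again a period, so every a contributes the
    -- same amount. For this the hypothesis must range over all starting points.
    iterate-window : ∀ j {f w} → (∀ s → window f s ℓ ≡ w) → ∀ s → window (iterate j f) s ℓ ≡ W ^ j * w
    iterate-window zero    {w = w} eq s = trans (eq s) (sym (*-identityˡ w))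
    iterate-window (suc j) {f} {w} eq s = begin
      total (λ i → total (λ a → iterate j f (s ℤ.+ + i ℤ.- a ℤ.* a)) interval) (downFrom ℓ)
        ≡⟨ total-swap _ (downFrom ℓ) interval ⟩
      total (λ a → total (λ i → iterate j f (s ℤ.+ + i ℤ.- a ℤ.* a)) (downFrom ℓ)) interval
        ≡⟨ total-cong (λ a → trans
             (total-cong (λ i → cong (iterate j f) (shift s (+ i) (a ℤ.* a))) (downFrom ℓ))
             (iterate-window j eq (s ℤ.- a ℤ.* a))) interval ⟩
      total (λ _ → W ^ j * w) interval
        ≡⟨ trans (total-const _ interval) (cong (_* (W ^ j * w)) length-interval) ⟩
      W * (W ^ j * w)
        ≡⟨ sym (*-assoc W (W ^ j) w) ⟩
      W ^ suc j * w ∎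
      where
      open ≡-Reasoning
      shift : ∀ s i a → s ℤ.+ i ℤ.- a ≡ s ℤ.- a ℤ.+ i
      shift = ℤ-Solver.solve-∀

    -- #{ α ∈ [-N, N]ᵗ | α₁² + ⋯ + αₜ² ≡ r mod ℓ } (total-vectors-∑²)
    P : ℕ → ℤ → ℕ
    P t = iterate t mult

    P-window : ∀ t s → window (P t) s ℓ ≡ W ^ t
    P-window t s = trans (iterate-window t window-multiples s) (*-identityʳ (W ^ t))

    P-≤ : ∀ t r → P t r ≤ W ^ t
    P-≤ t r = ≤-trans (iterate-≤ t {h = 1} (λ s → 𝟙≤1 (ℓ∣? s)) r) (≤-reflexive (*-identityʳ (W ^ t)))
      where
      𝟙≤1 : (d : Dec C) → 𝟙 d ≤ 1
      𝟙≤1 (yes _) = ≤-refl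
      𝟙≤1 (no _)  = z≤n

    ∃-P-below-average : ∀ t s → ∃ λ i → i ≤ pred ℓ × ℓ * P t (s ℤ.+ + i) ≤ W ^ t
    ∃-P-below-average t s = ∃≤average (λ i → ℓ * P t (s ℤ.+ + i)) (pred ℓ) (W ^ t)
      (subst (λ n → total (λ i → ℓ * P t (s ℤ.+ + i)) (downFrom n) ≤ n * W ^ t) (sym (suc-pred ℓ))
        (≤-reflexive (trans (total-*ˡ ℓ (λ i → P t (s ℤ.+ + i)) (downFrom ℓ))
          (cong (ℓ *_) (P-window t s)))))

    -- Some residue is at most average, so the whole excess `g` is missing there. A block of m = ℓ -
    -- 1 steps spreads this gap to every residue with weight ⌊W/ℓ⌋ᵐ ≥ Wᵐ/(B + 1), which leaves the
    -- fraction B/(B + 1) of the excess. After k blocks, ℓP/Wᵗ ≤ 1 + ℓ(B/(B + 1))ᵏ.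
    P-contraction : ∀ B m → suc m ≡ ℓ → W ^ m ≤ suc B * (W ℕ./ ℓ) ^ m → ∀ k s r →
      let t = k * m + s in
      suc B ^ k * (ℓ * P t r) ≤ suc B ^ k * W ^ t + B ^ k * (ℓ * W ^ t)
    P-contraction B m 1+m≡ℓ mixing zero s r = begin
      1 * (ℓ * P s r)            ≡⟨ *-identityˡ _ ⟩
      ℓ * P s r                  ≤⟨ *-monoʳ-≤ ℓ (P-≤ s r) ⟩
      ℓ * W ^ s                  ≡⟨ sym (*-identityˡ _) ⟩
      1 * (ℓ * W ^ s)            ≤⟨ m≤n+m _ (1 * W ^ s) ⟩
      1 * W ^ s + 1 * (ℓ * W ^ s) ∎
      where open ≤-Reasoning
    P-contraction B m 1+m≡ℓ mixing (suc k) s r = subst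
      (λ t → suc B ^ suc k * (ℓ * P t r) ≤ suc B ^ suc k * W ^ t + B ^ suc k * (ℓ * W ^ t))
      (sym (+-assoc m (k * m) s)) (+-cancelʳ-≤ (W ^ m * g) _ _ (begin
        suc B ^ suc k * (ℓ * P (m + t) r) + W ^ m * g
          ≡⟨ cong (λ z → z + W ^ m * g) (*-assoc (suc B) (suc B ^ k) _) ⟩
        suc B * (suc B ^ k * (ℓ * P (m + t) r)) + W ^ m * g
          ≤⟨ +-monoʳ-≤ (suc B * (suc B ^ k * (ℓ * P (m + t) r))) (*-monoˡ-≤ g mixing) ⟩
        suc B * (suc B ^ k * (ℓ * P (m + t) r)) + suc B * (W ℕ./ ℓ) ^ m * g
          ≡⟨ eq₁ (suc B) (suc B ^ k * (ℓ * P (m + t) r)) ((W ℕ./ ℓ) ^ m) g ⟩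
        suc B * (suc B ^ k * (ℓ * P (m + t) r) + (W ℕ./ ℓ) ^ m * g)
          ≤⟨ *-monoʳ-≤ (suc B) gap ⟩
        suc B * (W ^ m * h)
          ≡⟨ eq₂ B (W ^ m) (W ^ t) (suc B ^ k) (B ^ k) ℓ ⟩
        suc B * suc B ^ k * (W ^ m * W ^ t) + B * B ^ k * (ℓ * (W ^ m * W ^ t)) + W ^ m * g
          ≡⟨ cong (λ z → suc B ^ suc k * z + B ^ suc k * (ℓ * z) + W ^ m * g) (sym (^-distribˡ-+-* W m t)) ⟩
        suc B ^ suc k * W ^ (m + t) + B ^ suc k * (ℓ * W ^ (m + t)) + W ^ m * g ∎))
      where
      open ≤-Reasoning
      t g h : ℕ
      t = k * m + s
      g = B ^ k * (ℓ * W ^ t)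
      h = suc B ^ k * W ^ t + g
      f : ℤ → ℕ
      f r = suc B ^ k * (ℓ * P t r)
      eq₁ : ∀ b p c g → b * p + b * c * g ≡ b * (p + c * g)
      eq₁ = solve-∀
      eq₂ : ∀ b w v p q l → suc b * (w * (p * v + q * (l * v))) ≡
            suc b * p * (w * v) + b * q * (l * (w * v)) + w * (q * (l * v))
      eq₂ = eq₂′
        where
        eq₂′ : ∀ b w v p q l → (1 + b) * (w * (p * v + q * (l * v))) ≡
            (1 + b) * p * (w * v) + b * q * (l * (w * v)) + w * (q * (l * v))
        eq₂′ = solve-∀
      f-periodic : Periodic f
      f-periodic = periodic λ r s d → cong (λ z → suc B ^ k * (ℓ * z))
        (respects (iterate-periodic t mult-periodic) r s d)
      -- The period is chosen to end at `r`, so the residue found lies m - i ≤ m places before `r`,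
      -- within reach of one block.
      below : ∃ λ i → i ≤ pred ℓ × ℓ * P t (r ℤ.- + m ℤ.+ + i) ≤ W ^ t
      below = ∃-P-below-average t (r ℤ.- + m)
      i : ℕ
      i = proj₁ below
      i≤m : i ≤ m
      i≤m = subst (i ≤_) (cong pred (sym 1+m≡ℓ)) (proj₁ (proj₂ below))
      f₀-gap : f (r ℤ.- + m ℤ.+ + i) + g ≤ h
      f₀-gap = +-monoˡ-≤ g (*-monoʳ-≤ (suc B ^ k) (proj₂ (proj₂ below)))
      reach : r ℤ.- + m ℤ.+ + i ℤ.+ + (m ∸ i) ≡ r
      reach = trans (cong (λ z → r ℤ.- + m ℤ.+ + i ℤ.+ z)
          (trans (sym (ℤ.⊖-≥ i≤m)) (sym (ℤ.m-n≡m⊖n m i))))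
        (eq r (+ m) (+ i))
        where
        eq : ∀ r m i → r ℤ.- m ℤ.+ i ℤ.+ (m ℤ.- i) ≡ r
        eq = ℤ-Solver.solve-∀
      gap : suc B ^ k * (ℓ * P (m + t) r) + (W ℕ./ ℓ) ^ m * g ≤ W ^ m * h
      gap = subst (λ z → z + (W ℕ./ ℓ) ^ m * g ≤ W ^ m * h)
        (trans (cong (iterate m f) reach)
          (trans (iterate-*ˡ m (suc B ^ k) (λ s → ℓ * P t s) r)
            (cong (suc B ^ k *_) (trans (iterate-*ˡ m ℓ (P t) r) (cong (ℓ *_) (iterate-+ m t mult r))))))
        (iterate-gap f-periodic
          (λ s → P-contraction B m 1+m≡ℓ mixing k _ s)
          (r ℤ.- + m ℤ.+ + i) g f₀-gap m (m ∸ i) (m∸n≤m m i))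

-- Explicit rate of equidistribution

bernoulli : ∀ b j → b ^ j * (b + j) ≤ b * suc b ^ j
bernoulli b zero    = ≤-reflexive (eq b)
  where
  eq : ∀ b → 1 * (b + 0) ≡ b * 1
  eq = solve-∀
bernoulli b (suc j) = begin
  b * b ^ j * (b + suc j)       ≡⟨ eq₁ b (b ^ j) j ⟩
  b * (b ^ j * (b + j)) + b ^ j * b       ≤⟨ +-monoʳ-≤ (b * (b ^ j * (b + j))) (*-monoʳ-≤ (b ^ j) (m≤m+n b j)) ⟩
  b * (b ^ j * (b + j)) + b ^ j * (b + j) ≡⟨ +-comm _ (b ^ j * (b + j)) ⟩
  suc b * (b ^ j * (b + j))     ≤⟨ *-monoʳ-≤ (suc b) (bernoulli b j) ⟩
  suc b * (b * suc b ^ j)       ≡⟨ eq₂ b (suc b) (suc b ^ j) ⟩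
  b * (suc b * suc b ^ j)       ∎
  where
  open ≤-Reasoning
  eq₁ : ∀ b p j → b * p * (b + (1 + j)) ≡ b * (p * (b + j)) + p * b
  eq₁ = solve-∀
  eq₂ : ∀ b c p → c * (b * p) ≡ b * (c * p)
  eq₂ = solve-∀

-- Bernoulli's inequality gives (1 + 1/b)ʲ ≥ 1 + j/b > y. It yields the thresholds both for mixing
-- and for the decay of (3/4)ᵗ.
^-dominates : ∀ b y j → y * b < j → y * b ^ j ≤ suc b ^ j
^-dominates zero      y (suc j) _    = ≤-trans (≤-reflexive (*-zeroʳ y)) z≤n
^-dominates b@(suc _) y j       yb<j = *-cancelˡ-≤ b (begin
  b * (y * b ^ j)  ≡⟨ eq b y (b ^ j) ⟩
  b ^ j * (y * b)  ≤⟨ *-monoʳ-≤ (b ^ j) (≤-trans (<⇒≤ yb<j) (m≤n+m j b)) ⟩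
  b ^ j * (b + j)  ≤⟨ bernoulli b j ⟩
  b * suc b ^ j    ∎)
  where
  open ≤-Reasoning
  eq : ∀ b y p → b * (y * p) ≡ p * (y * b)
  eq = solve-∀

^-distribʳ-* : ∀ m n j → (m * n) ^ j ≡ m ^ j * n ^ j
^-distribʳ-* m n zero    = refl
^-distribʳ-* m n (suc j) = trans (cong (m * n *_) (^-distribʳ-* m n j))
  (eq m n (m ^ j) (n ^ j))
  where
  eq : ∀ m n p q → m * n * (p * q) ≡ m * p * (n * q)
  eq = solve-∀

module _ (ℓ : ℕ) .{{_ : NonZero ℓ}} where

  private
    -- A block has m = ℓ - 1 steps, each making the desired move with probability at least 1/2ℓ,
    -- because W ≤ 2ℓ⌊W/ℓ⌋ once W ≥ ℓ. The product of these bounds is 1/(K + 1).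
    m K : ℕ
    m = pred ℓ
    K = pred ((2 * ℓ) ^ m)

    instance
      2ℓ^m≢0 : NonZero ((2 * ℓ) ^ m)
      2ℓ^m≢0 = m^n≢0 (2 * ℓ) m {{m*n≢0 2 ℓ}}

    1+m≡ℓ : suc m ≡ ℓ
    1+m≡ℓ = suc-pred ℓ

    1+K≡ : suc K ≡ (2 * ℓ) ^ m
    1+K≡ = suc-pred ((2 * ℓ) ^ m)

    W≤2ℓc : ∀ w → ℓ ≤ w → w ≤ 2 * ℓ * (w ℕ./ ℓ)
    W≤2ℓc w ℓ≤w = begin
      w                            ≡⟨ ℕ.m≡m%n+[m/n]*n w ℓ ⟩
      w ℕ.% ℓ + w ℕ./ ℓ * ℓ        ≤⟨ +-monoˡ-≤ _ (<⇒≤ (ℕ.m%n<n w ℓ)) ⟩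
      ℓ + w ℕ./ ℓ * ℓ              ≡⟨ cong (λ z → z + w ℕ./ ℓ * ℓ) (sym (*-identityˡ ℓ)) ⟩
      1 * ℓ + w ℕ./ ℓ * ℓ          ≤⟨ +-monoˡ-≤ _ (*-monoˡ-≤ ℓ (ℕ.m≥n⇒m/n>0 ℓ≤w)) ⟩
      w ℕ./ ℓ * ℓ + w ℕ./ ℓ * ℓ    ≡⟨ eq (w ℕ./ ℓ) ℓ ⟩
      2 * ℓ * (w ℕ./ ℓ)            ∎
      where
      open ≤-Reasoning
      eq : ∀ c l → c * l + c * l ≡ 2 * l * c
      eq = solve-∀

    mixing : ∀ w → ℓ ≤ w → w ^ m ≤ suc K * (w ℕ./ ℓ) ^ m
    mixing w ℓ≤w = ≤-trans (^-monoˡ-≤ m (W≤2ℓc w ℓ≤w)) (≤-reflexive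
      (trans (^-distribʳ-* (2 * ℓ) (w ℕ./ ℓ) m) (cong (_* (w ℕ./ ℓ) ^ m) (sym 1+K≡))))

  -- By `^-dominates`, more than yℓK blocks suffice for ℓ(K/(K + 1))ᵏ ≤ 1/y.
  mixingTime : ℕ → ℕ
  mixingTime y = suc (y * ℓ * K) * m

  module _ (N : ℕ) (ℓ≤W : ℓ ≤ W ℓ N) (y t : ℕ) (t-large : mixingTime y ≤ t) where

    private
      w k : ℕ
      w = W ℓ N
      k = suc (y * ℓ * K)

    P-upper : ∀ r → y * (ℓ * P ℓ N t r) ≤ suc y * w ^ t
    P-upper r = *-cancelˡ-≤ (suc K ^ k) {{m^n≢0 (suc K) k}} (begin
      suc K ^ k * (y * (ℓ * P ℓ N t r))
        ≡⟨ eq₁ (suc K ^ k) y _ ⟩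
      y * (suc K ^ k * (ℓ * P ℓ N t r))
        ≤⟨ *-monoʳ-≤ y bound ⟩
      y * (suc K ^ k * w ^ t + K ^ k * (ℓ * w ^ t))
        ≡⟨ eq₂ y (suc K ^ k) (w ^ t) (K ^ k) ℓ ⟩
      y * (suc K ^ k * w ^ t) + y * ℓ * K ^ k * w ^ t
        ≤⟨ +-monoʳ-≤ (y * (suc K ^ k * w ^ t)) (*-monoˡ-≤ (w ^ t) (^-dominates K (y * ℓ) k ≤-refl)) ⟩
      y * (suc K ^ k * w ^ t) + suc K ^ k * w ^ t
        ≡⟨ eq₃ y (suc K ^ k) (w ^ t) ⟩
      suc K ^ k * (suc y * w ^ t) ∎)
      where
      open ≤-Reasoning
      bound : suc K ^ k * (ℓ * P ℓ N t r) ≤ suc K ^ k * w ^ t + K ^ k * (ℓ * w ^ t)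
      bound = subst (λ t → suc K ^ k * (ℓ * P ℓ N t r) ≤ suc K ^ k * w ^ t + K ^ k * (ℓ * w ^ t))
        (m+[n∸m]≡n t-large) (P-contraction ℓ N K m 1+m≡ℓ (mixing w ℓ≤W) k (t ∸ k * m) r)
      eq₁ : ∀ b y q → b * (y * q) ≡ y * (b * q)
      eq₁ = solve-∀
      eq₂ : ∀ y b v p l → y * (b * v + p * (l * v)) ≡ y * (b * v) + y * l * p * v
      eq₂ = solve-∀
      eq₃ : ∀ y b v → y * (b * v) + b * v ≡ b * (v + y * v)
      eq₃ = solve-∀

    -- The counts over a period add up to Wᵗ, so upper bounds at the other ℓ - 1 residues r + 1,
    -- ..., r + m bound the count at `r` from below. Their errors 1/y add up to less than ℓ/y.
    P-lower : ∀ r → y * w ^ t ≤ y * (ℓ * P ℓ N t r) + ℓ * w ^ t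
    P-lower r = +-cancelˡ-≤ (m * (y * w ^ t)) _ _ (begin
      m * (y * w ^ t) + y * w ^ t
        ≡⟨ trans (eq₁ m (y * w ^ t)) (cong (_* (y * w ^ t)) 1+m≡ℓ) ⟩
      ℓ * (y * w ^ t)
        ≡⟨ cong (λ z → ℓ * (y * z)) (sym (trans (cong (window p r) (trans (+-comm m 1) 1+m≡ℓ)) (P-window ℓ N t r))) ⟩
      ℓ * (y * window p r (m + 1))
        ≡⟨ cong (λ z → ℓ * (y * z)) (window-+ p r m 1) ⟩
      ℓ * (y * (window p (r ℤ.+ 1ℤ) m + (p (r ℤ.+ 0ℤ) + 0)))
        ≡⟨ cong (λ z → ℓ * (y * (window p (r ℤ.+ 1ℤ) m + (p z + 0)))) (ℤ.+-identityʳ r) ⟩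
      ℓ * (y * (window p (r ℤ.+ 1ℤ) m + (p r + 0)))
        ≡⟨ eq₂ ℓ y (window p (r ℤ.+ 1ℤ) m) (p r) ⟩
      y * ℓ * window p (r ℤ.+ 1ℤ) m + y * (ℓ * p r)
        ≤⟨ +-monoˡ-≤ _ others ⟩
      m * (suc y * w ^ t) + y * (ℓ * p r)
        ≡⟨ eq₃ m y (w ^ t) (y * (ℓ * p r)) ⟩
      m * (y * w ^ t) + (y * (ℓ * p r) + m * w ^ t)
        ≤⟨ +-monoʳ-≤ (m * (y * w ^ t)) (+-monoʳ-≤ (y * (ℓ * p r)) (*-monoˡ-≤ (w ^ t) (pred[n]≤n {ℓ}))) ⟩
      m * (y * w ^ t) + (y * (ℓ * p r) + ℓ * w ^ t) ∎)
      where
      open ≤-Reasoning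
      p : ℤ → ℕ
      p = P ℓ N t
      others : y * ℓ * window p (r ℤ.+ 1ℤ) m ≤ m * (suc y * w ^ t)
      others = ≤-trans (≤-reflexive (sym (total-*ˡ (y * ℓ) _ (downFrom m))))
        (≤-trans (total-mono (λ i → ≤-trans (≤-reflexive (*-assoc y ℓ _)) (P-upper (r ℤ.+ 1ℤ ℤ.+ + i))) (downFrom m))
          (≤-reflexive (trans (total-const _ (downFrom m)) (cong (_* (suc y * w ^ t)) (length-downFrom m)))))
      eq₁ : ∀ m v → m * v + v ≡ (1 + m) * v
      eq₁ = solve-∀
      eq₂ : ∀ l y a b → l * (y * (a + (b + 0))) ≡ y * l * a + y * (l * b)
      eq₂ = solve-∀
      eq₃ : ∀ m y v q → m * (v + y * v) + q ≡ m * (y * v) + (q + m * v)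
      eq₃ = solve-∀

-- Enumeration of the voltage assignments
vectors : List A → ∀ t → List (Vec A t)
vectors xs zero    = [] ∷ []
vectors xs (suc t) = cartesianProductWith _∷_ xs (vectors xs t)

vectors-unique : {xs : List A} → Unique xs → ∀ t → Unique (vectors xs t)
vectors-unique u zero    = [] ∷ []
vectors-unique u (suc t) = Unique.cartesianProductWith⁺ _∷_ Vec.∷-injective u (vectors-unique u t)

module _ (N : ℕ) where

  private
    -- This unfolds to the same list as `interval ℓ N`; the enumeration of the boxes does not
    -- involve the modulus.
    R : List ℤ
    R = map (λ i → ℤ.- + N ℤ.+ + i) (downFrom (suc (N + N)))

    -N+[N+a] : ∀ a → ℤ.- + N ℤ.+ (+ N ℤ.+ a) ≡ a
    -N+[N+a] a = trans (sym (ℤ.+-assoc (ℤ.- + N) (+ N) a))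
      (trans (cong (ℤ._+ a) (ℤ.+-inverseˡ (+ N))) (ℤ.+-identityˡ a))

  interval-unique : Unique R
  interval-unique = Unique.map⁺ (λ eq → ℤ.+-injective (∙-cancelˡ (ℤ.- + N) _ _ eq)) (Unique.downFrom⁺ _)
    where open import Algebra.Properties.AbelianGroup ℤ.+-0-abelianGroup using (∙-cancelˡ)

  ∈-interval⁺ : ∀ a → ∣ a ∣ ≤ N → a ∈ R
  ∈-interval⁺ (+ n)    n≤N = subst (_∈ R) (trans (cong (λ z → ℤ.- + N ℤ.+ z) (ℤ.pos-+ N n)) (-N+[N+a] (+ n)))
    (∈-map⁺ _ (∈-downFrom⁺ {i = N + n} (s≤s (+-monoʳ-≤ N n≤N))))
  ∈-interval⁺ -[1+ n ] n<N = subst (_∈ R)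
    (trans (cong (λ z → ℤ.- + N ℤ.+ z) (trans (sym (ℤ.⊖-≥ n<N)) (sym (ℤ.m-n≡m⊖n N (suc n))))) (-N+[N+a] -[1+ n ]))
    (∈-map⁺ _ (∈-downFrom⁺ {i = N ∸ suc n} (s≤s (≤-trans (m∸n≤m N (suc n)) (m≤m+n N N)))))

  ∈-interval⁻ : ∀ {a} → a ∈ R → ∣ a ∣ ≤ N
  ∈-interval⁻ a∈ with ∈-map⁻ _ a∈
  ... | i , i∈ , refl = subst (λ z → ∣ z ∣ ≤ N) (sym (trans (ℤ.+-comm (ℤ.- + N) (+ i)) (ℤ.m-n≡m⊖n i N))) bound
    where
    bound : ∣ i ℤ.⊖ N ∣ ≤ N
    bound with ≤-total N i
    ... | inj₁ N≤i = subst (λ z → ∣ z ∣ ≤ N) (sym (ℤ.⊖-≥ N≤i))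
            (≤-trans (∸-monoˡ-≤ N (≤-pred (∈-downFrom⁻ i∈))) (≤-reflexive (m+n∸n≡m N N)))
    ... | inj₂ i≤N = subst (_≤ N) (sym (ℤ.∣⊖∣-≤ i≤N)) (m∸n≤m N i)

  ∈-vectors⁺ : ∀ {t} (α : Vec ℤ t) → maxNorm α ≤ N → α ∈ vectors R t
  ∈-vectors⁺ []      _   = here refl
  ∈-vectors⁺ (a ∷ α) α≤N = ∈-cartesianProductWith⁺ _∷_
    (∈-interval⁺ a (m⊔n≤o⇒m≤o _ _ α≤N)) (∈-vectors⁺ α (m⊔n≤o⇒n≤o ∣ a ∣ _ α≤N))

  ∈-vectors⁻ : ∀ {t} (α : Vec ℤ t) → α ∈ vectors R t → maxNorm α ≤ N
  ∈-vectors⁻ []      _ = z≤n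
  ∈-vectors⁻ {suc t} (a ∷ α) ∈v with ∈-cartesianProductWith⁻ _∷_ R (vectors R t) ∈v
  ... | _ , _ , a∈ , α∈ , refl = ⊔-lub (∈-interval⁻ a∈) (∈-vectors⁻ α α∈)

  -- The assignments on 2, …, n + 1 loops with entries in [-N, N].
  box : ℕ → List VoltageAssignment
  box zero    = []
  box (suc n) = map (2 + n ,_) (vectors R (2 + n)) ++ box n

  ∈-box⁻ : ∀ n {t} {α : Vec ℤ t} → (t , α) ∈ box n → 2 ≤ t × t ≤ suc n × maxNorm α ≤ N
  ∈-box⁻ (suc n) ∈b with ∈-++⁻ (map (2 + n ,_) (vectors R (2 + n))) ∈b
  ... | inj₂ ∈b′ = let 2≤t , t≤ , α≤ = ∈-box⁻ n ∈b′ in 2≤t , m≤n⇒m≤1+n t≤ , α≤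
  ... | inj₁ ∈m with ∈-map⁻ _ ∈m
  ...   | α , α∈ , refl = s≤s (s≤s z≤n) , ≤-refl , ∈-vectors⁻ α α∈

  ∈-box⁺ : ∀ n {t} (α : Vec ℤ t) → 2 ≤ t → t ≤ suc n → maxNorm α ≤ N → (t , α) ∈ box n
  ∈-box⁺ zero    α 2≤t t≤1 _ = contradiction (≤-trans 2≤t t≤1) λ { (s≤s ()) }
  ∈-box⁺ (suc n) {t} α 2≤t t≤ α≤ with t ≟ 2 + n
  ... | yes refl = ∈-++⁺ˡ (∈-map⁺ _ (∈-vectors⁺ α α≤))
  ... | no  t≢   = ∈-++⁺ʳ _ (∈-box⁺ n α 2≤t (≤-pred (≤∧≢⇒< t≤ t≢)) α≤)

  box-unique : ∀ n → Unique (box n)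
  box-unique zero    = []
  box-unique (suc n) = Unique.++⁺ (Unique.map⁺ (λ { refl → refl }) (vectors-unique interval-unique (2 + n)))
    (box-unique n) disjoint
    where
    disjoint : Disjoint (map (2 + n ,_) (vectors R (2 + n))) (box n)
    disjoint (∈m , ∈b) with ∈-map⁻ _ ∈m
    ... | _ , _ , refl = contradiction (proj₁ (proj₂ (∈-box⁻ n ∈b))) (<⇒≱ ≤-refl)

  total-box : ∀ (f : VoltageAssignment → ℕ) n →
    total f (box n) ≡ total (λ i → total (λ α → f (2 + i , α)) (vectors R (2 + i))) (downFrom n)
  total-box f zero    = refl
  total-box f (suc n) = trans (total-++ f (map (2 + n ,_) (vectors R (2 + n))) (box n))
    (cong₂ _+_ (total-map f (2 + n ,_) (vectors R (2 + n))) (total-box f n))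

𝟙-¬? : {A : Set} (A? : Dec A) → 𝟙 (¬? A?) + 𝟙 A? ≡ 1
𝟙-¬? (yes _) = refl
𝟙-¬? (no _)  = refl

module _ (ℓ : ℕ) .{{_ : NonZero ℓ}} (N : ℕ) where

  private
    R : List ℤ
    R = interval ℓ N

  -- Splitting off the first coordinate a replaces r by r - a², which is the recursion behind `P`.
  total-vectors-∑² : ∀ t r → total (λ α → 𝟙 (ℓ∣?_ ℓ (r ℤ.- ∑² α))) (vectors R t) ≡ P ℓ N t r
  total-vectors-∑² zero    r = trans (+-identityʳ _) (cong (λ z → 𝟙 (ℓ∣?_ ℓ z)) (ℤ.+-identityʳ r))
  total-vectors-∑² (suc t) r = trans (total-cartesianProductWith (λ α → 𝟙 (ℓ∣?_ ℓ (r ℤ.- ∑² α))) _∷_ R (vectors R t))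
    (total-cong (λ a → trans (total-cong (λ α → cong (λ z → 𝟙 (ℓ∣?_ ℓ z)) (eq r (a ℤ.* a) (∑² α))) (vectors R t))
      (total-vectors-∑² t (r ℤ.- a ℤ.* a))) R)
    where
    eq : ∀ r a s → r ℤ.- (a ℤ.+ s) ≡ r ℤ.- a ℤ.- s
    eq = ℤ-Solver.solve-∀

  total-vectors-1 : ∀ t → total (λ _ → 1) (vectors R t) ≡ W ℓ N ^ t
  total-vectors-1 zero    = refl
  total-vectors-1 (suc t) = trans (total-cartesianProductWith (λ _ → 1) _∷_ R (vectors R t))
    (trans (total-cong (λ a → total-vectors-1 t) R)
      (trans (total-const (W ℓ N ^ t) R) (cong (_* W ℓ N ^ t) (length-interval ℓ N))))

  -- The indicator of (ℓℤ)ᵗ is written as a product so that its sum over a cube becomes a power.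
  -- Subtracting `0ℤ` makes the factors agree with those of `#residue ℓ N 0ℤ`.
  ∏multiple : ∀ {t} → Vec ℤ t → ℕ
  ∏multiple []      = 1
  ∏multiple (a ∷ α) = 𝟙 (ℓ∣?_ ℓ (a ℤ.- 0ℤ)) * ∏multiple α

  total-vectors-∏multiple : ∀ t → total ∏multiple (vectors R t) ≡ #residue ℓ N 0ℤ ^ t
  total-vectors-∏multiple zero    = refl
  total-vectors-∏multiple (suc t) = trans (total-cartesianProductWith ∏multiple _∷_ R (vectors R t))
    (trans (total-cong (λ a → trans (total-*ˡ (m a) ∏multiple (vectors R t))
        (trans (cong (m a *_) (total-vectors-∏multiple t)) (*-comm (m a) _))) R)
      (trans (total-*ˡ (#residue ℓ N 0ℤ ^ t) m R) (*-comm (#residue ℓ N 0ℤ ^ t) _)))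
    where
    m : ℤ → ℕ
    m a = 𝟙 (ℓ∣?_ ℓ (a ℤ.- 0ℤ))

  Admissible : ∀ {t} → Vec ℤ t → Set
  Admissible α = ∃ λ i → ¬ (+ ℓ ℤ.∣ lookup α i)

  admissible? : ∀ {t} (α : Vec ℤ t) → Dec (Admissible α)
  admissible? α = any? λ i → ¬? (ℓ∣?_ ℓ (lookup α i))

  admissible+∏multiple : ∀ {t} (α : Vec ℤ t) → 𝟙 (admissible? α) + ∏multiple α ≡ 1
  admissible+∏multiple []      = refl
  admissible+∏multiple (a ∷ α) = byCases (ℓ∣?_ ℓ (a ℤ.- 0ℤ))
    where
    byCases : (d : Dec (+ ℓ ℤ.∣ a ℤ.- 0ℤ)) → 𝟙 (admissible? (a ∷ α)) + 𝟙 d * ∏multiple α ≡ 1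
    byCases (yes ℓ∣a) = trans (cong₂ _+_
        (𝟙-cong (admissible? (a ∷ α)) (admissible? α)
          (λ { (zero , ℓ∤a) → contradiction (subst (+ ℓ ℤ.∣_) (ℤ.+-identityʳ a) ℓ∣a) ℓ∤a ; (suc i , ℓ∤) → i , ℓ∤ })
          λ (i , ℓ∤) → suc i , ℓ∤)
        (*-identityˡ _))
      (admissible+∏multiple α)
    byCases (no ℓ∤a) = trans (+-identityʳ _) (𝟙-cong (admissible? (a ∷ α)) (yes tt) (λ _ → tt)
      λ _ → zero , λ ℓ∣a → ℓ∤a (subst (+ ℓ ℤ.∣_) (sym (ℤ.+-identityʳ a)) ℓ∣a))

  -- This allows `list𝒯` to filter the whole box by the sum of squares alone.
  ∤∑²⇒admissible : ∀ {t} (α : Vec ℤ t) → ¬ (+ ℓ ℤ.∣ ∑² α) → Admissible α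
  ∤∑²⇒admissible []      ℓ∤ = contradiction (divides 0ℤ refl) ℓ∤
  ∤∑²⇒admissible (a ∷ α) ℓ∤ with ℓ∣?_ ℓ a
  ... | no  ℓ∤a = zero , ℓ∤a
  ... | yes ℓ∣a = let i , ℓ∤αᵢ = ∤∑²⇒admissible α (λ ℓ∣∑² → ℓ∤ (ℤ.∣m∣n⇒∣m+n (ℤ.∣m⇒∣m*n a ℓ∣a) ℓ∣∑²)) in suc i , ℓ∤αᵢ

  list𝒜 list𝒯 : ℕ → List VoltageAssignment
  list𝒜 n = filter (λ v → admissible? (proj₂ v)) (box N n)
  list𝒯 n = filter (λ v → ¬? (ℓ∣?_ ℓ (∑² (proj₂ v)))) (box N n)

  length-list𝒜 : ∀ n → length (list𝒜 n) + total (λ i → #residue ℓ N 0ℤ ^ (2 + i)) (downFrom n) ≡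
                       total (λ i → W ℓ N ^ (2 + i)) (downFrom n)
  length-list𝒜 n = trans (cong₂ _+_ (length-filter≡total _ (box N n))
      (trans (total-cong (λ i → sym (total-vectors-∏multiple (2 + i))) (downFrom n)) (sym (total-box N _ n))))
    (trans (sym (total-+ _ _ (box N n))) (trans (total-cong (λ v → admissible+∏multiple (proj₂ v)) (box N n))
      (trans (total-box N (λ _ → 1) n) (total-cong (λ i → total-vectors-1 (2 + i)) (downFrom n)))))

  length-list𝒯 : ∀ n → length (list𝒯 n) + total (λ i → P ℓ N (2 + i) 0ℤ) (downFrom n) ≡
                       total (λ i → W ℓ N ^ (2 + i)) (downFrom n)
  length-list𝒯 n = trans (cong₂ _+_ (length-filter≡total _ (box N n))
      (trans (total-cong (λ i → trans (sym (total-vectors-∑² (2 + i) 0ℤ))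
                 (total-cong (λ α → 𝟙-cong (ℓ∣?_ ℓ (0ℤ ℤ.- ∑² α)) (ℓ∣?_ ℓ (∑² α))
                   (unneg (∑² α)) (neg (∑² α))) (vectors R (2 + i))))
               (downFrom n)) (sym (total-box N _ n))))
    (trans (sym (total-+ _ _ (box N n))) (trans (total-cong (λ v → 𝟙-¬? (ℓ∣?_ ℓ (∑² (proj₂ v)))) (box N n))
      (trans (total-box N (λ _ → 1) n) (total-cong (λ i → total-vectors-1 (2 + i)) (downFrom n)))))
    where
    neg : ∀ s → + ℓ ℤ.∣ s → + ℓ ℤ.∣ 0ℤ ℤ.- s
    neg s d = subst (+ ℓ ℤ.∣_) (sym (ℤ.+-identityˡ (ℤ.- s))) (ℤ.∣m⇒∣-m d)
    unneg : ∀ s → + ℓ ℤ.∣ 0ℤ ℤ.- s → + ℓ ℤ.∣ s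
    unneg s d = subst (+ ℓ ℤ.∣_) (trans (cong ℤ.-_ (ℤ.+-identityˡ (ℤ.- s))) (ℤ.neg-involutive s)) (ℤ.∣m⇒∣-m d)

-- Error estimates for the proportion

module _ (y₀ ℓ T A S SP SZ V : ℕ) .{{_ : NonZero y₀}} .{{_ : NonZero ℓ}} where

  private
    y : ℕ
    y = 12 * y₀

    V≤ℓV : V ≤ ℓ * V
    V≤ℓV = m≤n*m V ℓ

  -- `S` counts all vectors of the box, `SP` those whose sum of squares is divisible by ℓ, `SZ`
  -- those with all entries divisible by ℓ, and `V` those with the largest t. Up to errors of order
  -- V/y the hypotheses say S = V, SZ = 0 and ℓ SP = V, whence T/A is close to 1 - 1/ℓ.
  module _ (T+SP≡S : T + SP ≡ S) (A+SZ≡S : A + SZ ≡ S) (V≤S : V ≤ S)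
           (S-small : y * S ≤ y * V + 2 * V) (SZ-small : y * SZ ≤ 3 * V)
           (lower : y * V ≤ y * (ℓ * SP) + ℓ * V)
           (upper : y * (ℓ * SP) ≤ suc y * V + 2 * (ℓ * V)) where

    open ≤-Reasoning

    -- As y ≥ 12, `SZ-small` allows at most V/4 excluded vectors. Errors measured by `V` can thus be
    -- measured by `A`, and `A` is positive when `V` is.
    V≤2A : V ≤ 2 * A
    V≤2A = *-cancelˡ-≤ y {{m*n≢0 12 y₀}} (+-cancelˡ-≤ (y * V) _ _ (begin
      y * V + y * V              ≡⟨ eq₁ y V ⟩
      2 * (y * V)                ≤⟨ *-monoʳ-≤ 2 (*-monoʳ-≤ y V≤S) ⟩
      2 * (y * S)                ≡⟨ cong (λ z → 2 * (y * z)) (sym A+SZ≡S) ⟩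
      2 * (y * (A + SZ))         ≡⟨ eq₂ y A SZ ⟩
      2 * (y * SZ) + y * (2 * A) ≤⟨ +-monoˡ-≤ _ (*-monoʳ-≤ 2 SZ-small) ⟩
      2 * (3 * V) + y * (2 * A)  ≤⟨ +-monoˡ-≤ _ 6V≤yV ⟩
      y * V + y * (2 * A)        ∎))
      where
      eq₁ : ∀ y v → y * v + y * v ≡ 2 * (y * v)
      eq₁ = solve-∀
      eq₂ : ∀ y a z → 2 * (y * (a + z)) ≡ 2 * (y * z) + y * (2 * a)
      eq₂ = solve-∀
      6V≤yV : 2 * (3 * V) ≤ y * V
      6V≤yV = ≤-trans (≤-reflexive (sym (*-assoc 2 3 V)))
        (*-monoˡ-≤ V (≤-trans (m≤m+n 6 6) (m≤m*n 12 y₀)))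

    private
      6ℓV≤12ℓA : 6 * (ℓ * V) ≤ 12 * (ℓ * A)
      6ℓV≤12ℓA = begin
        6 * (ℓ * V)       ≤⟨ *-monoʳ-≤ 6 (*-monoʳ-≤ ℓ V≤2A) ⟩
        6 * (ℓ * (2 * A)) ≡⟨ eq ℓ A ⟩
        12 * (ℓ * A)      ∎
        where
        eq : ∀ l a → 6 * (l * (2 * a)) ≡ 12 * (l * a)
        eq = solve-∀

    -- The errors add up to 6ℓV, here and in `proportion-≥`, hence to at most 12ℓA by `V≤2A`; this
    -- is the origin of the 12 in `y`.
    proportion-≤ : y₀ * (ℓ * T + A) ≤ y₀ * (ℓ * A) + ℓ * A
    proportion-≤ = *-cancelˡ-≤ 12 (+-cancelʳ-≤ (y * (ℓ * SP)) _ _ (begin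
      12 * (y₀ * (ℓ * T + A)) + y * (ℓ * SP)
        ≡⟨ eq₁ y₀ ℓ T A SP ⟩
      y * (ℓ * (T + SP)) + y * A
        ≡⟨ cong (λ z → y * (ℓ * z) + y * A) (trans T+SP≡S (sym A+SZ≡S)) ⟩
      y * (ℓ * (A + SZ)) + y * A
        ≡⟨ eq₂ y ℓ A SZ ⟩
      y * (ℓ * A) + (ℓ * (y * SZ) + y * A)
        ≤⟨ +-monoʳ-≤ (y * (ℓ * A)) (+-mono-≤ (*-monoʳ-≤ ℓ SZ-small) yA≤) ⟩
      y * (ℓ * A) + (ℓ * (3 * V) + (y * (ℓ * SP) + ℓ * V + 2 * (ℓ * V)))
        ≡⟨ eq₃ (y * (ℓ * A)) (y * (ℓ * SP)) ℓ V ⟩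
      y * (ℓ * A) + 6 * (ℓ * V) + y * (ℓ * SP)
        ≤⟨ +-monoˡ-≤ _ (+-monoʳ-≤ (y * (ℓ * A)) 6ℓV≤12ℓA) ⟩
      y * (ℓ * A) + 12 * (ℓ * A) + y * (ℓ * SP)
        ≡⟨ cong (_+ y * (ℓ * SP)) (eq₄ y₀ (ℓ * A)) ⟩
      12 * (y₀ * (ℓ * A) + ℓ * A) + y * (ℓ * SP) ∎))
      where
      yA≤ : y * A ≤ y * (ℓ * SP) + ℓ * V + 2 * (ℓ * V)
      yA≤ = ≤-trans (*-monoʳ-≤ y (≤-trans (m≤m+n A SZ) (≤-reflexive A+SZ≡S)))
        (≤-trans S-small (+-mono-≤ lower (*-monoʳ-≤ 2 V≤ℓV)))
      eq₁ : ∀ y₀ l t a s → 12 * (y₀ * (l * t + a)) + 12 * y₀ * (l * s) ≡ 12 * y₀ * (l * (t + s)) + 12 * y₀ * a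
      eq₁ = solve-∀
      eq₂ : ∀ y l a z → y * (l * (a + z)) + y * a ≡ y * (l * a) + (l * (y * z) + y * a)
      eq₂ = solve-∀
      eq₃ : ∀ p q l v → p + (l * (3 * v) + (q + l * v + 2 * (l * v))) ≡ p + 6 * (l * v) + q
      eq₃ = solve-∀
      eq₄ : ∀ y₀ a → 12 * y₀ * a + 12 * a ≡ 12 * (y₀ * a + a)
      eq₄ = solve-∀

    proportion-≥ : y₀ * (ℓ * A) ≤ y₀ * (ℓ * T + A) + ℓ * A
    proportion-≥ = *-cancelˡ-≤ 12 (begin
      12 * (y₀ * (ℓ * A))
        ≡⟨ sym (*-assoc 12 y₀ (ℓ * A)) ⟩
      y * (ℓ * A)
        ≤⟨ *-monoʳ-≤ y (*-monoʳ-≤ ℓ (≤-trans (m≤m+n A SZ) (≤-reflexive (trans A+SZ≡S (sym T+SP≡S))))) ⟩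
      y * (ℓ * (T + SP))
        ≡⟨ eq₁ y ℓ T SP ⟩
      y * (ℓ * T) + y * (ℓ * SP)
        ≤⟨ +-monoʳ-≤ (y * (ℓ * T)) (begin
             y * (ℓ * SP)                            ≤⟨ upper ⟩
             V + y * V + 2 * (ℓ * V)                 ≤⟨ +-monoˡ-≤ _ (+-mono-≤ V≤ℓV yV≤) ⟩
             ℓ * V + (y * A + 3 * (ℓ * V)) + 2 * (ℓ * V) ≡⟨ eq₂ (ℓ * V) (y * A) ⟩
             y * A + 6 * (ℓ * V)                     ≤⟨ +-monoʳ-≤ (y * A) 6ℓV≤12ℓA ⟩
             y * A + 12 * (ℓ * A) ∎) ⟩
      y * (ℓ * T) + (y * A + 12 * (ℓ * A))
        ≡⟨ eq₃ y₀ (ℓ * T) A (ℓ * A) ⟩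
      12 * (y₀ * (ℓ * T + A) + ℓ * A) ∎)
      where
      yV≤ : y * V ≤ y * A + 3 * (ℓ * V)
      yV≤ = begin
        y * V              ≤⟨ *-monoʳ-≤ y (≤-trans V≤S (≤-reflexive (sym A+SZ≡S))) ⟩
        y * (A + SZ)       ≡⟨ *-distribˡ-+ y A SZ ⟩
        y * A + y * SZ     ≤⟨ +-monoʳ-≤ (y * A) (≤-trans SZ-small (*-monoʳ-≤ 3 V≤ℓV)) ⟩
        y * A + 3 * (ℓ * V) ∎
      eq₁ : ∀ y l t s → y * (l * (t + s)) ≡ y * (l * t) + y * (l * s)
      eq₁ = solve-∀
      eq₂ : ∀ v a → v + (a + 3 * v) + 2 * v ≡ a + 6 * v
      eq₂ = solve-∀
      eq₃ : ∀ y₀ t a b → 12 * y₀ * t + (12 * y₀ * a + 12 * b) ≡ 12 * (y₀ * (t + a) + b)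
      eq₃ = solve-∀

total-powers-≤ : ∀ w → 2 ≤ w → ∀ n → total (λ i → w ^ (2 + i)) (downFrom n) ≤ 2 * w ^ (1 + n)
total-powers-≤ w 2≤w zero    = z≤n
total-powers-≤ w 2≤w (suc n) = begin
  w ^ (2 + n) + total (λ i → w ^ (2 + i)) (downFrom n) ≤⟨ +-monoʳ-≤ (w ^ (2 + n)) (total-powers-≤ w 2≤w n) ⟩
  w ^ (2 + n) + 2 * w ^ (1 + n)                        ≤⟨ +-monoʳ-≤ (w ^ (2 + n)) (*-monoˡ-≤ (w ^ (1 + n)) 2≤w) ⟩
  w ^ (2 + n) + w ^ (2 + n)                            ≡⟨ cong (_+_ (w ^ (2 + n))) (sym (+-identityʳ _)) ⟩
  2 * w ^ (2 + n)                                      ∎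
  where open ≤-Reasoning

module _ (ℓ : ℕ) .{{_ : NonZero ℓ}} (2≤ℓ : 2 ≤ ℓ) (y₀ : ℕ) .{{_ : NonZero y₀}} where

  private
    y : ℕ
    y = 12 * y₀

  -- The term 2ℓ ensures ⌊W/ℓ⌋ ≥ 2, and `y` ensures W ≥ y, so that all smaller t together contribute
  -- at most 2V/y. Among the loops, `mixingTime ℓ y` equidistributes the sum of squares and 3y
  -- brings (3/4)ᵗ below 1/y.
  minimalBound minimalLoops : ℕ
  minimalBound = 2 * ℓ + y
  minimalLoops = mixingTime ℓ y + y * 3

  module _ (N n : ℕ) (N-large : minimalBound ≤ N) (n-large : minimalLoops ≤ n) where

    private
      w z t V : ℕ
      w = W ℓ N
      z = #residue ℓ N 0ℤ
      t = 2 + n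
      V = w ^ t

      N≤w : N ≤ w
      N≤w = m≤n⇒m≤1+n (m≤m+n N N)
      2ℓ≤w : 2 * ℓ ≤ w
      2ℓ≤w = ≤-trans (≤-trans (m≤m+n (2 * ℓ) y) N-large) N≤w
      ℓ≤w : ℓ ≤ w
      ℓ≤w = ≤-trans (m≤n*m ℓ 2) 2ℓ≤w
      y≤w : y ≤ w
      y≤w = ≤-trans (≤-trans (m≤n+m y (2 * ℓ)) N-large) N≤w
      2≤w : 2 ≤ w
      2≤w = ≤-trans 2≤ℓ ℓ≤w

      -- The share of multiples of ℓ in [-N, N] must stay away from 1: it is at most (q + 1)/2q with
      -- q = ⌊W/ℓ⌋ ≥ 2.
      4z≤3w : 4 * z ≤ 3 * w
      4z≤3w = begin
        4 * z               ≤⟨ *-monoʳ-≤ 4 (#residue-≤ ℓ N 0ℤ) ⟩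
        4 * suc q           ≡⟨ eq₁ q ⟩
        2 * 2 + 4 * q       ≤⟨ +-monoˡ-≤ (4 * q) (*-monoʳ-≤ 2 2≤q) ⟩
        2 * q + 4 * q       ≡⟨ eq₂ q ⟩
        3 * (q * 2)         ≤⟨ *-monoʳ-≤ 3 (*-monoʳ-≤ q 2≤ℓ) ⟩
        3 * (q * ℓ)         ≤⟨ *-monoʳ-≤ 3 (ℕ.m/n*n≤m w ℓ) ⟩
        3 * w               ∎
        where
        open ≤-Reasoning
        q : ℕ
        q = w ℕ./ ℓ
        2≤q : 2 ≤ q
        2≤q = subst (_≤ q) (ℕ.m*n/n≡m 2 ℓ) (ℕ./-monoˡ-≤ ℓ 2ℓ≤w)
        eq₁ : ∀ q → 4 * (1 + q) ≡ 2 * 2 + 4 * q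
        eq₁ = solve-∀
        eq₂ : ∀ q → 2 * q + 4 * q ≡ 3 * (q * 2)
        eq₂ = solve-∀

      z≤w : z ≤ w
      z≤w = *-cancelˡ-≤ 4 (≤-trans 4z≤3w (*-monoˡ-≤ w (n≤1+n 3)))

      yzᵗ≤V : y * z ^ t ≤ V
      yzᵗ≤V = *-cancelˡ-≤ (4 ^ t) {{m^n≢0 4 t}} (begin
        4 ^ t * (y * z ^ t)  ≡⟨ eq₁ (4 ^ t) y (z ^ t) ⟩
        y * (4 ^ t * z ^ t)  ≡⟨ cong (y *_) (sym (^-distribʳ-* 4 z t)) ⟩
        y * (4 * z) ^ t      ≤⟨ *-monoʳ-≤ y (^-monoˡ-≤ t 4z≤3w) ⟩
        y * (3 * w) ^ t      ≡⟨ trans (cong (y *_) (^-distribʳ-* 3 w t)) (sym (*-assoc y (3 ^ t) V)) ⟩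
        y * 3 ^ t * V        ≤⟨ *-monoˡ-≤ V (^-dominates 3 y t y*3<t) ⟩
        4 ^ t * V            ∎)
        where
        open ≤-Reasoning
        eq₁ : ∀ a y b → a * (y * b) ≡ y * (a * b)
        eq₁ = solve-∀
        y*3<t : y * 3 < t
        y*3<t = s≤s (m≤n⇒m≤1+n (≤-trans (m≤n+m (y * 3) (mixingTime ℓ y)) n-large))

      -- The numbers of loops below the largest one; a total over `downFrom (suc n)` unfolds to its
      -- term at `t` plus this.
      low : (ℕ → ℕ) → ℕ
      low f = total (λ i → f (2 + i)) (downFrom n)

      low-small : ∀ f → (∀ i → f i ≤ w ^ i) → y * low f ≤ 2 * V
      low-small f f≤ = begin
        y * low f              ≤⟨ *-monoʳ-≤ y (total-mono (λ i → f≤ (2 + i)) (downFrom n)) ⟩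
        y * low (w ^_)         ≤⟨ *-mono-≤ y≤w (total-powers-≤ w 2≤w n) ⟩
        w * (2 * w ^ (1 + n))  ≡⟨ eq w (w ^ (1 + n)) ⟩
        2 * V                  ∎
        where
        open ≤-Reasoning
        eq : ∀ w v → w * (2 * v) ≡ 2 * (w * v)
        eq = solve-∀

      mixed : mixingTime ℓ y ≤ t
      mixed = m≤n⇒m≤1+n (m≤n⇒m≤1+n (≤-trans (m≤m+n (mixingTime ℓ y) (y * 3)) n-large))

      p : ℕ → ℕ
      p i = P ℓ N i 0ℤ

      S-small : y * (V + low (w ^_)) ≤ y * V + 2 * V
      S-small = ≤-trans (≤-reflexive (*-distribˡ-+ y V (low (w ^_))))
        (+-monoʳ-≤ (y * V) (low-small (w ^_) (λ _ → ≤-refl)))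

      SZ-small : y * (z ^ t + low (z ^_)) ≤ 3 * V
      SZ-small = ≤-trans (≤-reflexive (*-distribˡ-+ y (z ^ t) (low (z ^_))))
        (+-mono-≤ yzᵗ≤V (low-small (z ^_) (λ i → ^-monoˡ-≤ i z≤w)))

      lower : y * V ≤ y * (ℓ * (p t + low p)) + ℓ * V
      lower = ≤-trans (P-lower ℓ N ℓ≤w y t mixed 0ℤ)
        (+-monoˡ-≤ (ℓ * V) (*-monoʳ-≤ y (*-monoʳ-≤ ℓ (m≤m+n (p t) (low p)))))

      upper : y * (ℓ * (p t + low p)) ≤ suc y * V + 2 * (ℓ * V)
      upper = ≤-trans (≤-reflexive (eq₁ y ℓ (p t) (low p)))
        (+-mono-≤ (P-upper ℓ N ℓ≤w y t mixed 0ℤ)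
          (≤-trans (*-monoʳ-≤ ℓ (low-small p (λ i → P-≤ ℓ N i 0ℤ))) (≤-reflexive (eq₂ ℓ V))))
        where
        eq₁ : ∀ y l a b → y * (l * (a + b)) ≡ y * (l * a) + l * (y * b)
        eq₁ = solve-∀
        eq₂ : ∀ l v → l * (2 * v) ≡ 2 * (l * v)
        eq₂ = solve-∀

      #𝒯 #𝒜 : ℕ
      #𝒯 = length (list𝒯 ℓ N (suc n))
      #𝒜 = length (list𝒜 ℓ N (suc n))

    list-proportion-≤ : y₀ * (ℓ * #𝒯 + #𝒜) ≤ y₀ * (ℓ * #𝒜) + ℓ * #𝒜
    list-proportion-≤ = proportion-≤ y₀ ℓ #𝒯 #𝒜 (V + low (w ^_)) (p t + low p) (z ^ t + low (z ^_)) V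
      (length-list𝒯 ℓ N (suc n)) (length-list𝒜 ℓ N (suc n)) (m≤m+n V _) S-small SZ-small lower upper

    list-proportion-≥ : y₀ * (ℓ * #𝒜) ≤ y₀ * (ℓ * #𝒯 + #𝒜) + ℓ * #𝒜
    list-proportion-≥ = proportion-≥ y₀ ℓ #𝒯 #𝒜 (V + low (w ^_)) (p t + low p) (z ^ t + low (z ^_)) V
      (length-list𝒯 ℓ N (suc n)) (length-list𝒜 ℓ N (suc n)) (m≤m+n V _) S-small SZ-small lower upper

    #𝒜≢0 : NonZero #𝒜
    #𝒜≢0 = >-nonZero (*-cancelˡ-< 2 0 #𝒜 (<-≤-trans (m^n>0 w t)
      (V≤2A y₀ ℓ #𝒯 #𝒜 (V + low (w ^_)) (p t + low p) (z ^ t + low (z ^_)) V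
        (length-list𝒯 ℓ N (suc n)) (length-list𝒜 ℓ N (suc n)) (m≤m+n V _) S-small SZ-small lower upper)))

-- Real and rational numbers
/-mono-≤ : ∀ i m j n → i ℤ.* + suc n ℤ.≤ j ℤ.* + suc m → i ℚ./ suc m ℚ.≤ j ℚ./ suc n
/-mono-≤ i m j n le = ℚ.toℚᵘ-cancel-≤
  (ℚᵘ.≤-trans (ℚᵘ.≤-reflexive (ℚ.toℚᵘ-fromℚᵘ (mkℚᵘ i m)))
    (ℚᵘ.≤-trans (*≤* le) (ℚᵘ.≤-reflexive (ℚᵘ.≃-sym (ℚ.toℚᵘ-fromℚᵘ (mkℚᵘ j n))))))

fromℕ-mono-≤ : ∀ {m n} → m ≤ n → + m ℚ./ 1 ℚ.≤ + n ℚ./ 1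
fromℕ-mono-≤ {m} {n} m≤n = /-mono-≤ (+ m) 0 (+ n) 0 (ℤ.*-monoʳ-≤-nonNeg 1ℤ (ℤ.+≤+ m≤n))

archimedean : ∀ q → ∃ λ n → q ℚ.< + n ℚ./ 1
archimedean q@(ℚ.mkℚ a d-1 _) = suc ∣ a ∣ , ℚ.toℚᵘ-cancel-<
  (ℚᵘ.<-respʳ-≃ (ℚᵘ.≃-sym (ℚ.toℚᵘ-fromℚᵘ (mkℚᵘ (+ suc ∣ a ∣) 0))) (*<* (ℤ.≤-<-trans
    (ℤ.≤-trans (ℤ.≤-reflexive (ℤ.*-identityʳ a)) (i≤∣i∣ a))
    (ℤ.<-≤-trans (ℤ.+<+ ≤-refl) (ℤ.≤-trans (ℤ.+≤+ (m≤m*n (suc ∣ a ∣) (suc d-1)))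
      (ℤ.≤-reflexive (ℤ.pos-* (suc ∣ a ∣) (suc d-1))))))))
  where
  i≤∣i∣ : ∀ i → i ℤ.≤ + ∣ i ∣
  i≤∣i∣ (+ _)    = ℤ.≤-refl
  i≤∣i∣ -[1+ _ ] = ℤ.-≤+

∋-down-≤ : ∀ (x : ℝ) {p q} → p ℚ.≤ q → x ∋ q → x ∋ p
∋-down-≤ x {p} {q} p≤q x∋q with p ℚ.<? q
... | yes p<q = ℝ.down x p<q x∋q
... | no  p≮q = subst (x ∋_) (ℚ.≤-antisym (ℚ.≮⇒≥ p≮q) p≤q) x∋q

∋-1/n : ∀ (x : ℝ) → 0ᴿ <ᴿ x → ∃ λ n → x ∋ (1ℤ ℚ./ suc n)
∋-1/n x (p , p≮0 , x∋p) with ℝ.open-up x x∋p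
... | q , p<q , x∋q with ℚ.≤-<-trans (ℚ.≮⇒≥ p≮0) p<q
... | 0<q = let d , 1/d≤q = below q 0<q in d , ∋-down-≤ x 1/d≤q x∋q
  where
  below : ∀ q → 0ℚ ℚ.< q → ∃ λ d → 1ℤ ℚ./ suc d ℚ.≤ q
  below q@(ℚ.mkℚ (+ suc n) d _) _ = d , subst (1ℤ ℚ./ suc d ℚ.≤_) (ℚ.↥p/↧p≡p q)
    (/-mono-≤ 1ℤ d (+ suc n) d (ℤ.*-monoʳ-≤-nonNeg (+ suc d) (ℤ.+≤+ (s≤s (z≤n {n})))))
  below (ℚ.mkℚ (+ 0) d _)    (ℚ.*<* (ℤ.+<+ ()))
  below (ℚ.mkℚ -[1+ n ] d _) (ℚ.*<* ())

-- Descend from the bound: to refute the negated goal one may argue on whether `Q b` holds. If it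
-- does, `b` is the maximum; if not, `b` is a smaller bound.
¬¬-maximum : (Q : ℕ → Set) → (∀ {m n} → m ≤ n → Q n → Q m) → ∀ a → Q a → ∀ b → ¬ Q b →
             ¬ ¬ (∃ λ N → a ≤ N × (∀ n → Q n ⇔ n ≤ N))
¬¬-maximum Q down a Qa zero    ¬Q0 _ = ¬Q0 (down z≤n Qa)
¬¬-maximum Q down a Qa (suc b) ¬Qb k = ¬¬-maximum Q down a Qa b
  (λ Qb → k (b , ≮⇒≥ (λ b<a → ¬Qb (down b<a Qa)) , λ n →
    mk⇔ (λ Qn → ≮⇒≥ λ b<n → ¬Qb (down b<n Qn)) (λ n≤b → down n≤b Qb)))
  k

-- Constructively a real number has no floor, but it cannot fail to have one.
¬¬-floor : ∀ (x : ℝ) a → fromℕ a ≤ᴿ x → ¬ ¬ (∃ λ N → a ≤ N × (∀ n → fromℕ n ≤ᴿ x ⇔ n ≤ N))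
¬¬-floor x a a≤x = ¬¬-maximum (λ n → fromℕ n ≤ᴿ x)
  (λ m≤n n≤x q q<m → n≤x q (ℚ.<-≤-trans q<m (fromℕ-mono-≤ m≤n))) a a≤x b
  (λ b≤x → proj₂ (ℝ.bounded x) (b≤x _ (proj₂ (archimedean (proj₁ (ℝ.bounded x))))))
  where
  b : ℕ
  b = proj₁ (archimedean (proj₁ (ℝ.bounded x)))

1≤p⇒1≤p^n : ∀ {p} → 1ℚ ℚ.≤ p → ∀ n → 1ℚ ℚ.≤ p ^ℚ n
1≤p⇒p≤p^1+n : ∀ {p} → 1ℚ ℚ.≤ p → ∀ n → p ℚ.≤ p ^ℚ suc n
1≤p⇒1≤p^n 1≤p zero    = ℚ.≤-refl
1≤p⇒1≤p^n 1≤p (suc n) = ℚ.≤-trans 1≤p (1≤p⇒p≤p^1+n 1≤p n)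
1≤p⇒p≤p^1+n {p} 1≤p n = subst (ℚ._≤ p ^ℚ suc n) (ℚ.*-identityʳ p)
  (ℚ.*-monoˡ-≤-nonNeg p {{ℚ.nonNegative (ℚ.≤-trans (ℚ.nonNegative⁻¹ 1ℚ) 1≤p)}} (1≤p⇒1≤p^n 1≤p n))

-- Take 1/n < δ and y = (t + 1)ⁿ, so that y to the power 1/n is t + 1. Since δ < 1, the exponent n/n
-- lies above δ, and y ≥ 1 makes the second inequality of the power bound hold as well.
pow-unbounded : ∀ δ (0<δ : 0ᴿ <ᴿ δ) → δ <ᴿ 1ᴿ → ∀ t → ∃ λ X → ∀ x (0<x : 0ᴿ <ᴿ x) →
  fromℕ X ≤ᴿ x → fromℕ (suc t) ≤ᴿ pow x δ 0<x 0<δ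
pow-unbounded δ 0<δ (r , δ∌r , r<1) t = X , λ x 0<x X≤x q q<t → p , q<t , record
  { y = y ; m = 1 ; k = suc n-1 ; n-1 = n-1
  ; 0≤p = ℚ.≤-trans 0≤1 1≤p
  ; 0<y = ℚ.<-≤-trans (ℚ.positive⁻¹ 1ℚ) 1≤y
  ; y<x = X≤x y y<X
  ; m/n<δ = δ∋1/n
  ; δ≤k/n = λ δ∋n/n → δ∌r (∋-down-≤ δ (ℚ.≤-trans (ℚ.<⇒≤ r<1) 1≤n/n) δ∋n/n)
  ; p^n≤y^m = ℚ.≤-reflexive (sym (ℚ.*-identityʳ y))
  ; p^n≤y^k = 1≤p⇒p≤p^1+n 1≤y n-1
  }
  where
  n-1 : ℕ
  n-1 = proj₁ (∋-1/n δ 0<δ)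
  δ∋1/n : δ ∋ (1ℤ ℚ./ suc n-1)
  δ∋1/n = proj₂ (∋-1/n δ 0<δ)
  p y : ℚ
  p = + suc t ℚ./ 1
  y = p ^ℚ suc n-1
  X : ℕ
  X = proj₁ (archimedean y)
  y<X : y ℚ.< + X ℚ./ 1
  y<X = proj₂ (archimedean y)
  0≤1 : 0ℚ ℚ.≤ 1ℚ
  0≤1 = ℚ.nonNegative⁻¹ 1ℚ
  1≤p : 1ℚ ℚ.≤ p
  1≤p = fromℕ-mono-≤ {1} {suc t} (s≤s z≤n)
  1≤y : 1ℚ ℚ.≤ y
  1≤y = 1≤p⇒1≤p^n 1≤p (suc n-1)
  1≤n/n : + 1 ℚ./ 1 ℚ.≤ + suc n-1 ℚ./ suc n-1
  1≤n/n = /-mono-≤ (+ 1) 0 (+ suc n-1) n-1 (ℤ.≤-reflexive (ℤ.*-comm 1ℤ (+ suc n-1)))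

∣p∣≤q : ∀ {p q} → p ℚ.≤ q → ℚ.- p ℚ.≤ q → ℚ.∣ p ∣ ℚ.≤ q
∣p∣≤q {p} p≤q -p≤q with ℚ.∣p∣≡p∨∣p∣≡-p p
... | inj₁ eq = ℚ.≤-trans (ℚ.≤-reflexive eq) p≤q
... | inj₂ eq = ℚ.≤-trans (ℚ.≤-reflexive eq) -p≤q

-- Unnormalised rationals do not cancel common factors, so the difference has an explicit numerator
-- and denominator there, and both halves become integer inequalities.
distance-≤ : ∀ y ℓ t a →
  suc y * (suc ℓ * t + suc a) ≤ suc y * (suc ℓ * suc a) + suc ℓ * suc a →
  suc y * (suc ℓ * suc a) ≤ suc y * (suc ℓ * t + suc a) + suc ℓ * suc a →
  ℚ.∣ + t ℚ./ suc a ℚ.- (1ℚ ℚ.- 1ℤ ℚ./ suc ℓ) ∣ ℚ.≤ 1ℤ ℚ./ suc y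
distance-≤ y ℓ t a upper lower = ∣p∣≤q
  (ℚ.toℚᵘ-cancel-≤ (ℚᵘ.≤-trans (ℚᵘ.≤-reflexive difference)
    (ℚᵘ.≤-trans (*≤* upperℤ) (ℚᵘ.≤-reflexive (ℚᵘ.≃-sym (ℚ.toℚᵘ-fromℚᵘ (mkℚᵘ 1ℤ y)))))))
  (ℚ.toℚᵘ-cancel-≤ (ℚᵘ.≤-trans (ℚᵘ.≤-reflexive (ℚᵘ.≃-trans (ℚ.toℚᵘ-homo‿- d) (ℚᵘ.-‿cong difference)))
    (ℚᵘ.≤-trans (*≤* lowerℤ) (ℚᵘ.≤-reflexive (ℚᵘ.≃-sym (ℚ.toℚᵘ-fromℚᵘ (mkℚᵘ 1ℤ y)))))))
  where
  d : ℚ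
  d = + t ℚ./ suc a ℚ.- (1ℚ ℚ.- 1ℤ ℚ./ suc ℓ)

  homo-- : ∀ p q → ℚ.toℚᵘ (p ℚ.- q) ℚᵘ.≃ ℚ.toℚᵘ p ℚᵘ.- ℚ.toℚᵘ q
  homo-- p q = ℚᵘ.≃-trans (ℚ.toℚᵘ-homo-+ p (ℚ.- q)) (ℚᵘ.+-congʳ (ℚ.toℚᵘ p) (ℚ.toℚᵘ-homo‿- q))

  difference : ℚ.toℚᵘ d ℚᵘ.≃ mkℚᵘ (+ t) a ℚᵘ.- (mkℚᵘ 1ℤ 0 ℚᵘ.- mkℚᵘ 1ℤ ℓ)
  difference = ℚᵘ.≃-trans (homo-- (+ t ℚ./ suc a) (1ℚ ℚ.- 1ℤ ℚ./ suc ℓ))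
    (ℚᵘ.+-cong (ℚ.toℚᵘ-fromℚᵘ (mkℚᵘ (+ t) a)) (ℚᵘ.-‿cong
      (ℚᵘ.≃-trans (homo-- 1ℚ (1ℤ ℚ./ suc ℓ))
        (ℚᵘ.+-congʳ (mkℚᵘ 1ℤ 0) (ℚᵘ.-‿cong (ℚ.toℚᵘ-fromℚᵘ (mkℚᵘ 1ℤ ℓ)))))))

  Y L T A′ : ℤ
  Y = + suc y
  L = + suc ℓ
  T = + t
  A′ = + suc a

  cast-T : + (suc y * (suc ℓ * t + suc a)) ≡ Y ℤ.* (L ℤ.* T ℤ.+ A′)
  cast-T = trans (ℤ.pos-* (suc y) _) (cong (Y ℤ.*_)
    (trans (ℤ.pos-+ (suc ℓ * t) (suc a)) (cong (ℤ._+ A′) (ℤ.pos-* (suc ℓ) t))))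
  cast-A : + (suc y * (suc ℓ * suc a)) ≡ Y ℤ.* (L ℤ.* A′)
  cast-A = trans (ℤ.pos-* (suc y) _) (cong (Y ℤ.*_) (ℤ.pos-* (suc ℓ) (suc a)))
  denominator : 1ℤ ℤ.* + (suc a * (1 * suc ℓ)) ≡ L ℤ.* A′
  denominator = trans (ℤ.*-identityˡ _) (trans
    (cong +_ (trans (cong (suc a *_) (*-identityˡ (suc ℓ))) (*-comm (suc a) (suc ℓ))))
    (ℤ.pos-* (suc ℓ) (suc a)))

  numerator : ℤ
  numerator = T ℤ.* + (1 * suc ℓ) ℤ.+ (ℤ.- (1ℤ ℤ.* L ℤ.+ (ℤ.- 1ℤ) ℤ.* 1ℤ)) ℤ.* A′

  numerator′ : numerator ≡ T ℤ.* L ℤ.+ (ℤ.- (1ℤ ℤ.* L ℤ.+ (ℤ.- 1ℤ) ℤ.* 1ℤ)) ℤ.* A′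
  numerator′ = cong (λ z → T ℤ.* z ℤ.+ (ℤ.- (1ℤ ℤ.* L ℤ.+ (ℤ.- 1ℤ) ℤ.* 1ℤ)) ℤ.* A′) (cong +_ (*-identityˡ (suc ℓ)))

  upperℤ : numerator ℤ.* Y ℤ.≤ 1ℤ ℤ.* + (suc a * (1 * suc ℓ))
  upperℤ = subst₂ ℤ._≤_ (trans (eq₁ Y L T A′) (cong (ℤ._* Y) (sym numerator′)))
    (trans (eq₂ (Y ℤ.* (L ℤ.* A′)) (L ℤ.* A′)) (sym denominator))
    (ℤ.+-monoˡ-≤ (ℤ.- (Y ℤ.* (L ℤ.* A′)))
      (subst₂ ℤ._≤_ cast-T
        (trans (ℤ.pos-+ (suc y * (suc ℓ * suc a)) _) (cong₂ ℤ._+_ cast-A (ℤ.pos-* (suc ℓ) (suc a)))) (ℤ.+≤+ upper)))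
    where
    eq₁ : ∀ Y L T A′ → Y ℤ.* (L ℤ.* T ℤ.+ A′) ℤ.+ ℤ.- (Y ℤ.* (L ℤ.* A′)) ≡
          (T ℤ.* L ℤ.+ (ℤ.- (1ℤ ℤ.* L ℤ.+ (ℤ.- 1ℤ) ℤ.* 1ℤ)) ℤ.* A′) ℤ.* Y
    eq₁ = ℤ-Solver.solve-∀
    eq₂ : ∀ p q → p ℤ.+ q ℤ.+ ℤ.- p ≡ q
    eq₂ = ℤ-Solver.solve-∀

  lowerℤ : ℤ.- numerator ℤ.* Y ℤ.≤ 1ℤ ℤ.* + (suc a * (1 * suc ℓ))
  lowerℤ = subst₂ ℤ._≤_ (trans (eq₁ Y L T A′) (cong (λ z → ℤ.- z ℤ.* Y) (sym numerator′)))
    (trans (eq₂ (Y ℤ.* (L ℤ.* T ℤ.+ A′)) (L ℤ.* A′)) (sym denominator))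
    (ℤ.+-monoˡ-≤ (ℤ.- (Y ℤ.* (L ℤ.* T ℤ.+ A′)))
      (subst₂ ℤ._≤_ cast-A
        (trans (ℤ.pos-+ (suc y * (suc ℓ * t + suc a)) _) (cong₂ ℤ._+_ cast-T (ℤ.pos-* (suc ℓ) (suc a)))) (ℤ.+≤+ lower)))
    where
    eq₁ : ∀ Y L T A′ → Y ℤ.* (L ℤ.* A′) ℤ.+ ℤ.- (Y ℤ.* (L ℤ.* T ℤ.+ A′)) ≡
          ℤ.- (T ℤ.* L ℤ.+ (ℤ.- (1ℤ ℤ.* L ℤ.+ (ℤ.- 1ℤ) ℤ.* 1ℤ)) ℤ.* A′) ℤ.* Y
    eq₁ = ℤ-Solver.solve-∀
    eq₂ : ∀ p q → p ℤ.+ q ℤ.+ ℤ.- p ≡ q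
    eq₂ = ℤ-Solver.solve-∀
-- `TendsTo` speaks of every value in the graph, so cardinalities given by arbitrary lists have to
-- be identified with those of the explicit enumerations.
cardinality-unique : {A : Set} {P : A → Set} {m n : ℕ} → HasCardinality P m → HasCardinality P n → m ≡ n
cardinality-unique (xs , xs! , ∈xs , refl) (ys , ys! , ∈ys , refl) = unique-length xs! ys! λ a →
  mk⇔ (λ a∈ → Equivalence.from (∈ys a) (Equivalence.to (∈xs a) a∈))
      (λ a∈ → Equivalence.from (∈xs a) (Equivalence.to (∈ys a) a∈))

distance-1-1/ : ∀ y ℓ (ℓ-prime : Prime ℓ) t a (a≢0 : NonZero a) →
  suc y * (ℓ * t + a) ≤ suc y * (ℓ * a) + ℓ * a →
  suc y * (ℓ * a) ≤ suc y * (ℓ * t + a) + ℓ * a →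
  ℚ.∣ (+ t ℚ./ a) {{a≢0}} ℚ.- 1-1/ ℓ ℓ-prime ∣ ℚ.≤ 1ℤ ℚ./ suc y
distance-1-1/ y zero    ℓ-prime = contradiction (prime⇒nonZero ℓ-prime) λ ()
distance-1-1/ y (suc ℓ) ℓ-prime t (suc a) _ = distance-≤ y ℓ t a

-- The two sets at a given x, and the limit

module _ (ℓ : ℕ) (ℓ-prime : Prime ℓ) (δ : ℝ) (0<δ : 0ᴿ <ᴿ δ) (x : ℝ) (0<x : 0ᴿ <ᴿ x) where

  open Counting ℓ ℓ-prime δ 0<δ
  open PadicProperties ℓ ℓ-prime using (invariants⇒∤; ∤⇒invariants)

  private instance
    ℓ≢0 : NonZero ℓ
    ℓ≢0 = prime⇒nonZero ℓ-prime

  -- `box N n` goes up to n + 1 loops, hence the shift in the floor of the power.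
  module _ (N n : ℕ) (N-floor : ∀ k → fromℕ k ≤ᴿ x ⇔ k ≤ N)
           (n-floor : ∀ k → fromℕ k ≤ᴿ pow x δ 0<x 0<δ ⇔ k ≤ suc n) where

    ∈-box⇔ : ∀ t (α : Vec ℤ t) → (t , α) ∈ box N n ⇔
      (2 ≤ t × fromℕ t ≤ᴿ pow x δ 0<x 0<δ × fromℕ (maxNorm α) ≤ᴿ x)
    ∈-box⇔ t α = mk⇔
      (λ ∈b → let 2≤t , t≤ , α≤ = ∈-box⁻ N n ∈b in
         2≤t , Equivalence.from (n-floor t) t≤ , Equivalence.from (N-floor (maxNorm α)) α≤)
      (λ (2≤t , t≤ , α≤) → ∈-box⁺ N n α 2≤t
         (Equivalence.to (n-floor t) t≤) (Equivalence.to (N-floor (maxNorm α)) α≤))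

    𝒜-cardinality : HasCardinality (𝒜 x 0<x) (length (list𝒜 ℓ N n))
    𝒜-cardinality = list𝒜 ℓ N n , Unique.filter⁺ _ (box-unique N n) , (λ (t , α) → mk⇔
      (λ ∈l → let ∈b , adm = ∈-filter⁻ _ {xs = box N n} ∈l
                  2≤t , t≤ , α≤ = Equivalence.to (∈-box⇔ t α) ∈b
              in  2≤t , t≤ , α≤ , adm)
      (λ (2≤t , t≤ , α≤ , adm) → ∈-filter⁺ _ (Equivalence.from (∈-box⇔ t α) (2≤t , t≤ , α≤)) adm)) , refl

    𝒯-cardinality : HasCardinality (𝒯 0 1ℤ x 0<x) (length (list𝒯 ℓ N n))
    𝒯-cardinality = list𝒯 ℓ N n , Unique.filter⁺ _ (box-unique N n) , (λ (t , α) → mk⇔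
      (λ ∈l → let ∈b , ℓ∤∑² = ∈-filter⁻ _ {xs = box N n} ∈l
                  2≤t , t≤ , α≤ = Equivalence.to (∈-box⇔ t α) ∈b
              in  (2≤t , t≤ , α≤ , ∤∑²⇒admissible ℓ N α ℓ∤∑²) ,
                  ∤⇒invariants α (λ j → Padic.fromℤ ℓ (lookup α j)) (λ _ → refl) ℓ∤∑²)
      (λ ((2≤t , t≤ , α≤ , _) , inv) → ∈-filter⁺ _ (Equivalence.from (∈-box⇔ t α) (2≤t , t≤ , α≤))
         (invariants⇒∤ α (λ j → Padic.fromℤ ℓ (lookup α j)) (λ _ → refl) inv))) , refl

theorem4p21 : (ℓ : ℕ) (ℓ-prime : Prime ℓ) → ℓ ≢ 2 →
    (δ : ℝ) (0<δ : 0ᴿ <ᴿ δ) → δ <ᴿ 1ᴿ →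
    TendsTo (Counting.Proportion ℓ ℓ-prime δ 0<δ 0 1ℤ) (1-1/ ℓ ℓ-prime)
theorem4p21 ℓ ℓ-prime _ δ 0<δ δ<1 ε 0<ε = fromℕ X , λ x 0<x X≤x →
    -- The claim is a double negation, so the floors may be assumed.
    (λ undefined → floors x 0<x X≤x λ (N , n , N-large , n-large , N-floor , n-floor) →
      undefined (_ , _ , _ , #𝒜≢0 ℓ 2≤ℓ (suc y) N n N-large n-large ,
        𝒯-cardinality ℓ ℓ-prime δ 0<δ x 0<x N (suc n) N-floor n-floor ,
        𝒜-cardinality ℓ ℓ-prime δ 0<δ x 0<x N (suc n) N-floor n-floor , refl)) ,
    -- The witness 1/(y + 1) depends on ε alone; what remains to be shown of the distance is a
    -- negation, under which the floors are available again.
    λ { _ (#𝒯 , #𝒜 , #𝒜≢0 , 𝒯-card , 𝒜-card , refl) → 1ℤ ℚ./ suc y ,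
      (λ 1/y<distance → floors x 0<x X≤x λ (N , n , N-large , n-large , N-floor , n-floor) →
        let #𝒯≡ = cardinality-unique (𝒯-cardinality ℓ ℓ-prime δ 0<δ x 0<x N (suc n) N-floor n-floor) 𝒯-card
            #𝒜≡ = cardinality-unique (𝒜-cardinality ℓ ℓ-prime δ 0<δ x 0<x N (suc n) N-floor n-floor) 𝒜-card
        in  ℚ.<-irrefl refl (ℚ.<-≤-trans 1/y<distance (distance-1-1/ y ℓ ℓ-prime #𝒯 #𝒜 #𝒜≢0
              (subst₂ (λ T A → suc y * (ℓ * T + A) ≤ suc y * (ℓ * A) + ℓ * A) #𝒯≡ #𝒜≡
                (list-proportion-≤ ℓ 2≤ℓ (suc y) N n N-large n-large))
              (subst₂ (λ T A → suc y * (ℓ * A) ≤ suc y * (ℓ * T + A) + ℓ * A) #𝒯≡ #𝒜≡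
                (list-proportion-≥ ℓ 2≤ℓ (suc y) N n N-large n-large))))) ,
      proj₂ (∋-1/n ε 0<ε) }
  where
  instance
    ℓ≢0 : NonZero ℓ
    ℓ≢0 = prime⇒nonZero ℓ-prime
  2≤ℓ : 2 ≤ ℓ
  2≤ℓ = nonTrivial⇒n>1 ℓ {{prime⇒nonTrivial ℓ-prime}}
  y N₀ n₀ X₁ X : ℕ
  y = proj₁ (∋-1/n ε 0<ε)
  N₀ = minimalBound ℓ 2≤ℓ (suc y)
  n₀ = minimalLoops ℓ 2≤ℓ (suc y)
  X₁ = proj₁ (pow-unbounded δ 0<δ δ<1 (suc n₀))
  -- `N₀` makes the range of the entries large enough, and `X₁` makes x^δ at least n₀ + 2.
  X = N₀ ⊔ X₁

  floors : ∀ x 0<x → fromℕ X ≤ᴿ x → ¬ ¬ (∃ λ N → ∃ λ n → N₀ ≤ N × n₀ ≤ n ×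
    (∀ k → fromℕ k ≤ᴿ x ⇔ k ≤ N) × (∀ k → fromℕ k ≤ᴿ pow x δ 0<x 0<δ ⇔ k ≤ suc (suc n)))
  floors x 0<x X≤x none = ¬¬-floor x N₀ (weaken (m≤m⊔n N₀ X₁)) λ (N , N-large , N-floor) →
    ¬¬-floor (pow x δ 0<x 0<δ) (2 + n₀)
      (proj₂ (pow-unbounded δ 0<δ δ<1 (suc n₀)) x 0<x (weaken (m≤n⊔m N₀ X₁)))
      λ { (suc (suc n) , s≤s (s≤s n-large) , n-floor) → none (N , n , N-large , n-large , N-floor , n-floor) }
    where
    weaken : ∀ {m} → m ≤ X → fromℕ m ≤ᴿ x
    weaken m≤X q q<m = X≤x q (ℚ.<-≤-trans q<m (fromℕ-mono-≤ m≤X))
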